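{- Let $\mathcal P$ be a finite chiral polytope of type $\{p_1, \ldots, p_{n-1}\}$. Define $\ell_i = \mathrm{lcm}(p_i, p_{n-i})$ for $i = 1, \ldots, n-1$, and let $\ell = \mathrm{lcm}(\ell_1/p_1, \ldots, \ell_{n-1}/p_{n-1})$. If \[ |\Gamma^+(\mathcal P) \mathbin{\square} \Gamma^+(\overline{\mathcal P})| < \ell \, |\Gamma^+(\mathcal P) \mathbin{\square} \Gamma^+(\mathcal P^{\delta})|, \] then $\mathcal P \diamond \mathcal P^{\delta}$ is chiral.
   Context: An abstract polytope of rank $n$ (an $n$-polytope) is a ranked poset of faces with ranks from $-1$ to $n$, with a unique least face (rank $-1$) and a unique greatest face (rank $n$), in which every flag (maximal chain) has $n+2$ faces, which satisfies the diamond condition (whenever $F<G$ with ranks $j-1$ and $j+1$ there are exactly two $j$-faces strictly between them), and which is strongly flag-connected (any two flags $\Phi,\Psi$ are joined by a sequence of flags, consecutive ones adjacent, all containing $\Phi\cap\Psi$; two flags are adjacent if they differ in exactly one face). $\Phi^j$ denotes the unique flag differing from $\Phi$ only in its $j$-face, and $\Phi^{i,j}=(\Phi^i)^j$. Each polytope considered has a fixed base flag $\Phi$. $\mathcal P$ is chiral if its automorphism group $\Gamma(\mathcal P)$ has exactly two orbits on flags and adjacent flags lie in distinct orbits; then $\Gamma^+(\mathcal P):=\Gamma(\mathcal P)$ is generated by $\sigma_1,\dots,\sigma_{n-1}$, where $\sigma_i$ maps $\Phi$ to $\Phi^{i,i-1}$. One has $(\sigma_i\cdots\sigma_j)^2=1$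 for $i<j$, and the type of $\mathcal P$ is $\{p_1,\dots,p_{n-1}\}$ where $p_i$ is the order of $\sigma_i$. Let $W^+=\langle \sigma_1,\dots,\sigma_{n-1}\mid (\sigma_i\cdots\sigma_j)^2=1 \text{ for } 1\le i<j\le n-1\rangle$. Writing $\Gamma^+(\mathcal P)=W^+/M$ means that $M$ is the kernel of the epimorphism $W^+\to\Gamma^+(\mathcal P)$ preserving the specified generators. For $w\in W^+$, $\overline w$ is obtained by replacing $\sigma_1$ by $\sigma_1^{ -1}$, $\sigma_2$ by $\sigma_1^2\sigma_2$ and fixing $\sigma_j$ for $j\ge3$; $\delta(w)$ is obtained by replacing each $\sigma_i$ by $\sigma_{n-i}^{ -1}$ (both are automorphisms of $W^+$). Put $\overline M=\{\overline w:w\in M\}$, $\delta(M)=\{\delta(w):w\in M\}$. If $\Gamma^+(\mathcal P)=W^+/M$ with $\mathcal P$ chiral, then $\overline M\ne M$; the mirror image $\overline{\mathcal P}$ (same faces, base flag $\Phi^0$) has $\Gamma^+(\overline{\mathcal P})=W^+/\overline M$, and the dual $\mathcal P^\delta$ (reversed order) has $\Gamma^+(\mathcal P^\delta)=W^+/\delta(M)$. Mix and comix: for groups with specified generators $\Gamma=\langle x_1,\dots,x_k\mid R\rangle$, $\Gamma'=\langle x_1',\dots,x_k'\mid S\rangle$, the mix $\Gamma\diamond\Gamma'$ is the subgroup of $\Gamma\times\Gamma'$ generated by $(x_i,x_i')$, $i=1,\dots,k$, and the comix $\Gamma\mathbin{\square}\Gamma'$ is the group $\langle x_1,x_1',\dots,x_k,x_k'\mid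 R,S,x_1^{ -1}x_1',\dots,x_k^{ -1}x_k'\rangle$. $\mathcal P\diamond\mathcal Q$ is the flag-connected pre-polytope (polytope axioms with strong flag-connectedness weakened to flag-connectedness) built from $\Gamma^+(\mathcal P)\diamond\Gamma^+(\mathcal Q)$; it is handled through $\Gamma^+(\mathcal P\diamond\mathcal Q)=\Gamma^+(\mathcal P)\diamond\Gamma^+(\mathcal Q)=W^+/N$, and it is directly regular if $\overline N=N$ and chiral if $\overline N\ne N$ (it need not be polytopal). -}

module Defs where

open import Algebra.Bundles using (Group)
import Algebra.Construct.DirectProduct as DirectProduct
import Algebra.Definitions.RawMonoid as RawMonoid
open import Data.Fin.Base using (Fin; zero; suc; toℕ; fromℕ; inject₁; opposite)
import Data.Fin.Base as Fin
import Data.Fin.Properties as Finₚ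
open import Data.List.Base using (List; length; foldr; map; filter; allFin)
open import Data.List.Membership.Propositional using (_∈_)
open import Data.List.Relation.Unary.All as All using (All)
open import Data.List.Relation.Unary.AllPairs as AllPairs using (AllPairs)
open import Data.List.Relation.Unary.Unique.Propositional using (Unique)
open import Data.Nat.Base using (ℕ; zero; suc; _+_; _/_; NonZero; >-nonZero; z≤n; s≤s)
import Data.Nat.Base as ℕ
open import Data.Nat.LCM using (lcm)
import Data.Nat.Properties as ℕₚ
open import Data.Product.Base using (Σ; ∃; ∃₂; _×_; _,_; proj₁; proj₂)
open import Data.Sum.Base using (_⊎_; inj₁; inj₂)
import Data.Sum.Base as Sum
open import Data.Vec.Functional using (updateAt)
open import Data.Vec.Functional.Properties using (updateAt-updates; updateAt-minimal)
open import Function.Base using (_∘_; const; flip)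
open import Function.Bundles using (Inverse; _↔_)
open import Level using (0ℓ)
open import Relation.Binary.Construct.Closure.ReflexiveTransitive using (Star)
import Relation.Binary.Construct.Closure.ReflexiveTransitive as Star
import Relation.Binary.Construct.Flip.EqAndOrd as Flip
import Relation.Binary.Construct.NonStrictToStrict as Strict
open import Relation.Binary.Core using (Rel)
open import Relation.Binary.Morphism.Structures using (IsOrderIsomorphism)
import Relation.Binary.Morphism.Construct.Composition as Comp
import Relation.Binary.Morphism.Construct.Identity as Id
open import Relation.Binary.PropositionalEquality using (_≡_; _≢_; refl; sym; trans; cong; subst₂; setoid; module ≡-Reasoning)
open import Relation.Binary.Structures using (IsPartialOrder)
open import Relation.Nullary using (¬_; yes; no; contradiction)
open import Relation.Nullary.Decidable using (_×-dec_)
open import Relation.Unary using (Pred; _≐_)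

module Order {Face : Set} (_≤_ : Rel Face 0ℓ) where

  open Strict _≡_ _≤_ public using (_<_)

  Comparable : Rel Face 0ℓ
  Comparable F G = F ≤ G ⊎ G ≤ F

  record MaximalChain (c : List Face) : Set where
    field
      unique  : Unique c
      chain   : AllPairs Comparable c
      maximal : ∀ F → All (Comparable F) c → F ∈ c

  -- A flag, listed in increasing order.  In a polytope of rank n the maximal
  -- chains are exactly the chains of n + 2 faces, and `face i` is then the
  -- face of rank i - 1 (see `rank-face`).
  record Flag (n : ℕ) : Set where
    field
      face      : Fin (2 + n) → Face
      ascending : ∀ {i j} → i Fin.< j → face i < face j

  open Flag public

  module _ {n : ℕ} where

    infix 4 _≈_ _∈F_

    _≈_ : Rel (Flag n) 0ℓ
    Φ ≈ Ψ = ∀ i → face Φ i ≡ face Ψ i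

    _∈F_ : Face → Flag n → Set
    F ∈F Φ = ∃ λ i → face Φ i ≡ F

    AdjacentAt : Fin (2 + n) → Rel (Flag n) 0ℓ
    AdjacentAt j Φ Ψ = face Φ j ≢ face Ψ j × (∀ i → i ≢ j → face Φ i ≡ face Ψ i)

    Adjacent : Rel (Flag n) 0ℓ
    Adjacent Φ Ψ = ∃ λ j → AdjacentAt j Φ Ψ

    StronglyJoined : Rel (Flag n) 0ℓ
    StronglyJoined Φ Ψ = ∃ λ Ψ′ → Star Step Φ Ψ′ × Ψ′ ≈ Ψ
      where
      Step : Rel (Flag n) 0ℓ
      Step Χ Ω = Adjacent Χ Ω × (∀ F → F ∈F Φ → F ∈F Ψ → F ∈F Ω)

ExactlyTwo : {A : Set} → Pred A 0ℓ → Set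
ExactlyTwo P = ∃₂ λ x y → x ≢ y × P x × P y × (∀ z → P z → z ≡ x ⊎ z ≡ y)

-- Ranks -1, …, n are stored shifted by one, as elements of Fin (2 + n).
record Polytope (n : ℕ) : Set₁ where
  infix 4 _≤_
  field
    Face           : Set
    _≤_            : Rel Face 0ℓ
    isPartialOrder : IsPartialOrder _≡_ _≤_

  open Order _≤_ public

  field
    rank            : Face → Fin (2 + n)
    rank-mono       : ∀ {F G} → F < G → rank F Fin.< rank G
    least           : Face
    least-least     : ∀ F → least ≤ F
    least-rank      : rank least ≡ zero
    greatest        : Face
    greatest-great  : ∀ F → F ≤ greatest
    greatest-rank   : rank greatest ≡ fromℕ (suc n)
    maximal-length  : ∀ c → MaximalChain c → length c ≡ 2 + n
    diamond         : ∀ {F G} → F < G → toℕ (rank G) ≡ 2 + toℕ (rank F) →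
                      ExactlyTwo (λ H → toℕ (rank H) ≡ 1 + toℕ (rank F) × F < H × H < G)
    strongly-connected : (Φ Ψ : Flag n) → StronglyJoined Φ Ψ

private
  lower : ∀ {m} (f : Fin (suc m) → ℕ) → (∀ {i j} → i Fin.< j → f i ℕ.< f j) →
          ∀ c → c ℕ.≤ f zero → ∀ i → c + toℕ i ℕ.≤ f i
  lower f mono c c≤ zero = ℕₚ.≤-trans (ℕₚ.≤-reflexive (ℕₚ.+-identityʳ c)) c≤
  lower {suc m} f mono c c≤ (suc i) =
    ℕₚ.≤-trans (ℕₚ.≤-reflexive (ℕₚ.+-suc c (toℕ i)))
      (lower (f ∘ suc) (λ i<j → mono (s≤s i<j)) (suc c)
        (ℕₚ.≤-trans (s≤s c≤) (mono (s≤s z≤n))) i)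

  upper : ∀ {m} (f : Fin (suc m) → ℕ) → (∀ {i j} → i Fin.< j → f i ℕ.< f j) →
          ∀ b → (∀ i → f i ℕ.≤ b) → ∀ i → f i + m ℕ.≤ b + toℕ i
  upper {zero} f mono b ≤b zero = ℕₚ.+-monoˡ-≤ 0 (≤b zero)
  upper {suc m} f mono b ≤b zero = ℕₚ.≤-trans (ℕₚ.≤-reflexive (ℕₚ.+-suc (f zero) m))
    (ℕₚ.≤-trans (ℕₚ.+-monoˡ-≤ m (mono {zero} {suc zero} (s≤s z≤n)))
      (upper (f ∘ suc) (λ i<j → mono (s≤s i<j)) b (λ i → ≤b (suc i)) zero))
  upper {suc m} f mono b ≤b (suc i) = ℕₚ.≤-trans (ℕₚ.≤-reflexive (ℕₚ.+-suc (f (suc i)) m))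
    (ℕₚ.≤-trans (s≤s (upper (f ∘ suc) (λ i<j → mono (s≤s i<j)) b (λ j → ≤b (suc j)) i))
      (ℕₚ.≤-reflexive (sym (ℕₚ.+-suc b (toℕ i)))))

  increasing⇒id : ∀ {m} (f : Fin (suc m) → Fin (suc m)) →
                  (∀ {i j} → i Fin.< j → f i Fin.< f j) → ∀ i → f i ≡ i
  increasing⇒id {m} f mono i = Finₚ.toℕ-injective (ℕₚ.≤-antisym
    (ℕₚ.+-cancelʳ-≤ m (toℕ (f i)) (toℕ i) (ℕₚ.≤-trans
      (upper (toℕ ∘ f) mono m (λ j → Finₚ.toℕ≤pred[n] (f j)) i)
      (ℕₚ.≤-reflexive (ℕₚ.+-comm m (toℕ i)))))
    (lower (toℕ ∘ f) mono 0 z≤n i))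

  opposite-sum : ∀ {m} (i : Fin (suc m)) → toℕ i + toℕ (opposite i) ≡ m
  opposite-sum {m} i = trans (cong (toℕ i +_) (Finₚ.opposite-prop i)) (ℕₚ.m+[n∸m]≡n (Finₚ.toℕ≤pred[n] i))

  opposite-< : ∀ {m} {i j : Fin m} → i Fin.< j → opposite j Fin.< opposite i
  opposite-< {suc m} {i} {j} i<j = ℕₚ.+-cancelˡ-< (toℕ i) _ _ (begin-strict
    toℕ i + toℕ (opposite j)  <⟨ ℕₚ.+-monoˡ-< (toℕ (opposite j)) i<j ⟩
    toℕ j + toℕ (opposite j)  ≡⟨ opposite-sum j ⟩
    m                         ≡⟨ opposite-sum i ⟨
    toℕ i + toℕ (opposite i)  ∎)
    where open ℕₚ.≤-Reasoning

  opposite-shift : ∀ {m} k {i j : Fin (suc m)} → toℕ (opposite i) ≡ k + toℕ (opposite j) → toℕ j ≡ k + toℕ i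
  opposite-shift {m} k {i} {j} eq = ℕₚ.+-cancelʳ-≡ (toℕ (opposite j)) (toℕ j) (k + toℕ i) (begin
    toℕ j + toℕ (opposite j)        ≡⟨ opposite-sum j ⟩
    m                               ≡⟨ opposite-sum i ⟨
    toℕ i + toℕ (opposite i)        ≡⟨ cong (toℕ i +_) eq ⟩
    toℕ i + (k + toℕ (opposite j))  ≡⟨ ℕₚ.+-assoc (toℕ i) k _ ⟨
    toℕ i + k + toℕ (opposite j)    ≡⟨ cong (_+ toℕ (opposite j)) (ℕₚ.+-comm (toℕ i) k) ⟩
    k + toℕ i + toℕ (opposite j)    ∎)
    where open ≡-Reasoning

  opposite-shift⁻¹ : ∀ {m} k {i j : Fin (suc m)} → toℕ j ≡ k + toℕ i → toℕ (opposite i) ≡ k + toℕ (opposite j)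
  opposite-shift⁻¹ k {i} {j} eq = opposite-shift k
    (trans (cong toℕ (Finₚ.opposite-involutive j)) (trans eq (cong ((k +_) ∘ toℕ) (sym (Finₚ.opposite-involutive i)))))

-- The position in a flag of its j-face, 0 ≤ j ≤ n - 1.
position : ∀ {n} → Fin n → Fin (2 + n)
position j = suc (inject₁ j)

module FlagExchange {n : ℕ} (P : Polytope n) where
  open Polytope P

  private
    <-trans : ∀ {F G H} → F < G → G < H → F < H
    <-trans = Strict.<-trans _≡_ _≤_ isPartialOrder

  rank-face : (Φ : Flag n) → ∀ i → rank (face Φ i) ≡ i
  rank-face Φ = increasing⇒id (rank ∘ face Φ) (rank-mono ∘ ascending Φ)

  private
    module Replace (Φ : Flag n) (j : Fin n) where
      below above : Fin (2 + n)
      below = inject₁ (inject₁ j)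
      above = suc (suc j)

      toℕ-below : toℕ below ≡ toℕ j
      toℕ-below = trans (Finₚ.toℕ-inject₁ (inject₁ j)) (Finₚ.toℕ-inject₁ j)

      toℕ-position : toℕ (position j) ≡ suc (toℕ j)
      toℕ-position = cong suc (Finₚ.toℕ-inject₁ j)

      Between : Face → Set
      Between H = toℕ (rank H) ≡ 1 + toℕ (rank (face Φ below)) × face Φ below < H × H < face Φ above

      below<pos : below Fin.< position j
      below<pos = ℕₚ.≤-reflexive (trans (cong suc toℕ-below) (sym toℕ-position))

      pos<above : position j Fin.< above
      pos<above = ℕₚ.≤-reflexive (cong suc toℕ-position)

      face-between : Between (face Φ (position j))
      face-between = (begin
        toℕ (rank (face Φ (position j)))   ≡⟨ cong toℕ (rank-face Φ (position j)) ⟩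
        toℕ (position j)                   ≡⟨ toℕ-position ⟩
        suc (toℕ j)                        ≡⟨ cong suc toℕ-below ⟨
        suc (toℕ below)                    ≡⟨ cong (suc ∘ toℕ) (rank-face Φ below) ⟨
        suc (toℕ (rank (face Φ below)))    ∎) , ascending Φ below<pos , ascending Φ pos<above
        where open ≡-Reasoning

      two : ExactlyTwo Between
      two = diamond (ascending Φ (ℕₚ.<-trans below<pos pos<above)) (begin
        toℕ (rank (face Φ above))              ≡⟨ cong toℕ (rank-face Φ above) ⟩
        2 + toℕ j                              ≡⟨ cong (2 +_) toℕ-below ⟨
        2 + toℕ below                          ≡⟨ cong ((2 +_) ∘ toℕ) (rank-face Φ below) ⟨
        2 + toℕ (rank (face Φ below))          ∎)
        where open ≡-Reasoning

      other : ∃ λ H → face Φ (position j) ≢ H × Between H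
      other with two
      ... | H₁ , H₂ , H₁≢H₂ , b₁ , b₂ , only with only _ face-between
      ...   | inj₁ eq = H₂ , (λ e → H₁≢H₂ (trans (sym eq) e)) , b₂
      ...   | inj₂ eq = H₁ , (λ e → H₁≢H₂ (trans (sym e) eq)) , b₁

      H : Face
      H = proj₁ other

      below<H : face Φ below < H
      below<H = proj₁ (proj₂ (proj₂ (proj₂ other)))

      H<above : H < face Φ above
      H<above = proj₂ (proj₂ (proj₂ (proj₂ other)))

      <H : ∀ i → i Fin.< position j → face Φ i < H
      <H i i<j with i Finₚ.≟ below
      ... | yes refl = below<H
      ... | no i≢    = <-trans (ascending Φ (ℕₚ.≤∧≢⇒<
        (ℕₚ.≤-trans (ℕₚ.≤-pred (ℕₚ.≤-trans i<j (ℕₚ.≤-reflexive toℕ-position))) (ℕₚ.≤-reflexive (sym toℕ-below)))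
        (i≢ ∘ Finₚ.toℕ-injective))) below<H

      H< : ∀ i → position j Fin.< i → H < face Φ i
      H< i j<i with i Finₚ.≟ above
      ... | yes refl = H<above
      ... | no i≢    = <-trans H<above (ascending Φ (ℕₚ.≤∧≢⇒<
        (ℕₚ.≤-trans (ℕₚ.≤-reflexive (cong suc (sym toℕ-position))) j<i)
        (i≢ ∘ sym ∘ Finₚ.toℕ-injective)))

      newFace : Fin (2 + n) → Face
      newFace = updateAt (face Φ) (position j) (const H)

      at : newFace (position j) ≡ H
      at = updateAt-updates (position j) (face Φ)

      off : ∀ i → i ≢ position j → newFace i ≡ face Φ i
      off i = updateAt-minimal i (position j) (face Φ)

      newAscending : ∀ {i k} → i Fin.< k → newFace i < newFace k
      newAscending {i} {k} i<k with i Finₚ.≟ position j | k Finₚ.≟ position j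
      ... | yes refl | yes refl = contradiction i<k (ℕₚ.<-irrefl refl)
      ... | yes refl | no k≢    = subst₂ _<_ (sym at) (sym (off k k≢)) (H< k i<k)
      ... | no i≢    | yes refl = subst₂ _<_ (sym (off i i≢)) (sym at) (<H i i<k)
      ... | no i≢    | no k≢    = subst₂ _<_ (sym (off i i≢)) (sym (off k k≢)) (ascending Φ i<k)

  infixl 8 _^_

  -- The flag Φ^j; Φ ^ i ^ j is (Φ^i)^j.
  _^_ : Flag n → Fin n → Flag n
  Φ ^ j = record { face = newFace ; ascending = newAscending }
    where open Replace Φ j

  ^-adjacentAt : ∀ Φ j → AdjacentAt (position j) Φ (Φ ^ j)
  ^-adjacentAt Φ j = (λ e → proj₁ (proj₂ other) (trans e at)) , (λ i i≢ → sym (off i i≢))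
    where open Replace Φ j

module Automorphisms {n : ℕ} (P : Polytope n) where
  open Polytope P

  record Automorphism : Set where
    field
      to                 : Face → Face
      isOrderIsomorphism : IsOrderIsomorphism _≡_ _≡_ _≤_ _≤_ to
    open IsOrderIsomorphism isOrderIsomorphism public using (mono; cancel; injective; surjective)

    from : Face → Face
    from F = proj₁ (surjective F)

    to-from : ∀ F → to (from F) ≡ F
    to-from F = proj₂ (surjective F) refl

    from-to : ∀ F → from (to F) ≡ F
    from-to F = injective (to-from (to F))

  open Automorphism public

  identity : Automorphism
  identity = record { to = λ F → F ; isOrderIsomorphism = Id.isOrderIsomorphism _≡_ _≤_ refl }

  infixl 7 _then_

  _then_ : Automorphism → Automorphism → Automorphism
  α then β = record
    { to = to β ∘ to α
    ; isOrderIsomorphism = Comp.isOrderIsomorphism trans (isOrderIsomorphism α) (isOrderIsomorphism β)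
    }

  inverse : Automorphism → Automorphism
  inverse α = record
    { to = from α
    ; isOrderIsomorphism = record
      { isOrderMonomorphism = record
        { isOrderHomomorphism = record
          { cong = cong (from α)
          ; mono = λ {F} {G} F≤G → cancel α (subst₂ _≤_ (sym (to-from α F)) (sym (to-from α G)) F≤G)
          }
        ; injective = λ {F} {G} e → trans (sym (to-from α F)) (trans (cong (to α) e) (to-from α G))
        ; cancel = λ {F} {G} le → subst₂ _≤_ (to-from α F) (to-from α G) (mono α le)
        }
      ; surjective = λ F → to α F , λ { refl → from-to α F }
      }
    }

  -- Products act from the left factor to the right one (Φ(αβ) = (Φα)β); this is
  -- the convention under which (σᵢ⋯σⱼ)² = 1 for all i < j.
  Γ : Group 0ℓ 0ℓ
  Γ = record
    { Carrier = Automorphism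
    ; _≈_ = λ α β → ∀ F → to α F ≡ to β F
    ; _∙_ = _then_
    ; ε = identity
    ; _⁻¹ = inverse
    ; isGroup = record
      { isMonoid = record
        { isSemigroup = record
          { isMagma = record
            { isEquivalence = record
              { refl = λ F → refl
              ; sym = λ e F → sym (e F)
              ; trans = λ e e′ F → trans (e F) (e′ F)
              }
            ; ∙-cong = λ {α} {α′} {β} {β′} e e′ F → trans (cong (to β) (e F)) (e′ (to α′ F))
            }
          ; assoc = λ α β γ F → refl
          }
        ; identity = (λ α F → refl) , (λ α F → refl)
        }
      ; inverse = to-from , from-to
      ; ⁻¹-cong = λ {α} {β} e F →
          injective α (trans (to-from α F) (trans (sym (to-from β F)) (sym (e (from β F)))))
      }
    }

  act : Automorphism → Flag n → Flag n
  act α Φ = record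
    { face = to α ∘ face Φ
    ; ascending = λ i<j → mono α (proj₁ (ascending Φ i<j)) , proj₂ (ascending Φ i<j) ∘ injective α
    }

  SameOrbit : Rel (Flag n) 0ℓ
  SameOrbit Φ Ψ = ∃ λ α → act α Φ ≈ Ψ

  record Chiral : Set where
    field
      two-orbits : ∃₂ λ Φ₁ Φ₂ → ¬ SameOrbit Φ₁ Φ₂ × (∀ Ψ → SameOrbit Φ₁ Ψ ⊎ SameOrbit Φ₂ Ψ)
      adjacent-distinct : ∀ Φ Ψ → Adjacent Φ Ψ → ¬ SameOrbit Φ Ψ

  orbit-join : ∀ Φ Ψ Ω → SameOrbit Φ Ψ → SameOrbit Φ Ω → SameOrbit Ψ Ω
  orbit-join Φ Ψ Ω (α , e) (β , e′) = (inverse α then β) ,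
    λ i → trans (cong (to β) (trans (cong (from α) (sym (e i))) (from-to α _))) (e′ i)

  distinct-twice : Chiral → ∀ Φ Ψ Ω → ¬ SameOrbit Φ Ψ → ¬ SameOrbit Ψ Ω → SameOrbit Φ Ω
  distinct-twice ch Φ Ψ Ω Φ≁Ψ Ψ≁Ω with Chiral.two-orbits ch
  ... | Φ₁ , Φ₂ , _ , either with either Φ | either Ψ | either Ω
  ... | inj₁ a | inj₁ b | _      = contradiction (orbit-join Φ₁ Φ Ψ a b) Φ≁Ψ
  ... | inj₂ a | inj₂ b | _      = contradiction (orbit-join Φ₂ Φ Ψ a b) Φ≁Ψ
  ... | _      | inj₁ b | inj₁ c = contradiction (orbit-join Φ₁ Ψ Ω b c) Ψ≁Ω
  ... | _      | inj₂ b | inj₂ c = contradiction (orbit-join Φ₂ Ψ Ω b c) Ψ≁Ω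
  ... | inj₁ a | inj₂ _ | inj₁ c = orbit-join Φ₁ Φ Ω a c
  ... | inj₂ a | inj₁ _ | inj₂ c = orbit-join Φ₂ Φ Ω a c

module _ {n : ℕ} (P : Polytope n) where
  private module P = Polytope P

  private
    Pᵒ : Rel P.Face 0ℓ
    Pᵒ = flip P._≤_
    module D = Order Pᵒ

  reverseFlag : P.Flag n → D.Flag n
  reverseFlag Φ = record
    { face = P.face Φ ∘ opposite
    ; ascending = λ i<j → let le , ne = P.ascending Φ (opposite-< i<j) in le , ne ∘ sym
    }

  private
    unreverse : D.Flag n → P.Flag n
    unreverse Φ = record
      { face = D.face Φ ∘ opposite
      ; ascending = λ i<j → let le , ne = D.ascending Φ (opposite-< i<j) in le , ne ∘ sym
      }

    opp-opp : ∀ {A : Set} {k} (f : Fin k → A) i → f (opposite (opposite i)) ≡ f i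
    opp-opp f i = cong f (Finₚ.opposite-involutive i)

    opp-≢ : ∀ {k} {i j : Fin k} → i ≢ opposite j → opposite i ≢ j
    opp-≢ {_} {i} i≢ e = i≢ (trans (sym (Finₚ.opposite-involutive i)) (cong opposite e))

    reverse-adjacent : ∀ Φ Ψ → P.Adjacent Φ Ψ → D.Adjacent (reverseFlag Φ) (reverseFlag Ψ)
    reverse-adjacent Φ Ψ (j , ne , eq) = opposite j ,
      (λ e → ne (trans (sym (opp-opp (P.face Φ) j)) (trans e (opp-opp (P.face Ψ) j)))) ,
      (λ i i≢ → eq (opposite i) (opp-≢ i≢))

    unreverse-adjacent : ∀ Φ Ψ → D.Adjacent Φ Ψ → P.Adjacent (unreverse Φ) (unreverse Ψ)
    unreverse-adjacent Φ Ψ (j , ne , eq) = opposite j ,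
      (λ e → ne (trans (sym (opp-opp (D.face Φ) j)) (trans e (opp-opp (D.face Ψ) j)))) ,
      (λ i i≢ → eq (opposite i) (opp-≢ i≢))

    flip-< : ∀ {F G} → F D.< G → G P.< F
    flip-< (le , ne) = le , ne ∘ sym

    unflip-< : ∀ {F G} → F P.< G → G D.< F
    unflip-< (le , ne) = le , ne ∘ sym

    connected : (Φ Ψ : D.Flag n) → D.StronglyJoined Φ Ψ
    connected Φ Ψ with P.strongly-connected (unreverse Φ) (unreverse Ψ)
    ... | Ω , path , Ω≈Ψ with path
    ...   | Star.ε = Φ , Star.ε , λ i →
              trans (sym (opp-opp (D.face Φ) i)) (trans (Ω≈Ψ (opposite i)) (opp-opp (D.face Ψ) i))
    ...   | Star._◅_ {j = Χ₁} (adj , has) steps =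
              reverseFlag Ω ,
              (first Χ₁ adj , contain Χ₁ has) Star.◅ Star.gmap reverseFlag (λ {Χ} {Χ′} (a , h) → reverse-adjacent Χ Χ′ a , contain Χ′ h) steps ,
              λ i → trans (Ω≈Ψ (opposite i)) (opp-opp (D.face Ψ) i)
      where
      first : ∀ Χ → P.Adjacent (unreverse Φ) Χ → D.Adjacent Φ (reverseFlag Χ)
      first Χ (j , ne , eq) = opposite j ,
        (λ e → ne (trans e (opp-opp (P.face Χ) j))) ,
        (λ i i≢ → trans (sym (opp-opp (D.face Φ) i)) (eq (opposite i) (opp-≢ i≢)))

      down : ∀ {F} Χ → F D.∈F Χ → F P.∈F unreverse Χ
      down Χ (i , e) = opposite i , trans (opp-opp (D.face Χ) i) e

      contain : ∀ Χ → (∀ F → F P.∈F unreverse Φ → F P.∈F unreverse Ψ → F P.∈F Χ) →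
                ∀ F → F D.∈F Φ → F D.∈F Ψ → F D.∈F reverseFlag Χ
      contain Χ h F F∈Φ F∈Ψ with h F (down Φ F∈Φ) (down Ψ F∈Ψ)
      ... | i , e = opposite i , trans (opp-opp (P.face Χ) i) e

  dual : Polytope n
  dual = record
    { Face = P.Face
    ; _≤_ = Pᵒ
    ; isPartialOrder = Flip.isPartialOrder P.isPartialOrder
    ; rank = opposite ∘ P.rank
    ; rank-mono = λ F<G → opposite-< (P.rank-mono (flip-< F<G))
    ; least = P.greatest
    ; least-least = P.greatest-great
    ; least-rank = trans (cong opposite P.greatest-rank) (Finₚ.opposite-involutive zero)
    ; greatest = P.least
    ; greatest-great = P.least-least
    ; greatest-rank = cong opposite P.least-rank
    ; maximal-length = λ c mc → let open D.MaximalChain mc in P.maximal-length c (record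
        { unique = unique
        ; chain = AllPairs.map Sum.swap chain
        ; maximal = λ F comp → maximal F (All.map Sum.swap comp)
        })
    ; diamond = λ {F} {G} F<G eq → dual-diamond F G F<G eq
    ; strongly-connected = connected
    }
    where
    dual-diamond : ∀ F G → F D.< G → toℕ (opposite (P.rank G)) ≡ 2 + toℕ (opposite (P.rank F)) →
      ExactlyTwo (λ H → toℕ (opposite (P.rank H)) ≡ 1 + toℕ (opposite (P.rank F)) × F D.< H × H D.< G)
    dual-diamond F G F<G eq with P.diamond (flip-< F<G) (opposite-shift 2 eq)
    ... | H₁ , H₂ , ne , b₁ , b₂ , only = H₁ , H₂ , ne , turn b₁ , turn b₂ , λ H b → only H (turn⁻¹ b)
      where
      rankF : toℕ (P.rank F) ≡ 2 + toℕ (P.rank G)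
      rankF = opposite-shift 2 eq

      turn : ∀ {H} → toℕ (P.rank H) ≡ 1 + toℕ (P.rank G) × G P.< H × H P.< F →
             toℕ (opposite (P.rank H)) ≡ 1 + toℕ (opposite (P.rank F)) × F D.< H × H D.< G
      turn (r , G<H , H<F) = opposite-shift⁻¹ 1 (trans rankF (cong suc (sym r))) , unflip-< H<F , unflip-< G<H

      turn⁻¹ : ∀ {H} → toℕ (opposite (P.rank H)) ≡ 1 + toℕ (opposite (P.rank F)) × F D.< H × H D.< G →
               toℕ (P.rank H) ≡ 1 + toℕ (P.rank G) × G P.< H × H P.< F
      turn⁻¹ (r , F<H , H<G) =
        ℕₚ.suc-injective (trans (sym (opposite-shift 1 r)) rankF) , flip-< H<G , flip-< F<H

  private
    module AP = Automorphisms P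
    module AD = Automorphisms dual

    toDual : AP.Automorphism → AD.Automorphism
    toDual α = record
      { to = AP.to α
      ; isOrderIsomorphism = record
        { isOrderMonomorphism = record
          { isOrderHomomorphism = record { cong = cong (AP.to α) ; mono = AP.mono α }
          ; injective = AP.injective α
          ; cancel = AP.cancel α
          }
        ; surjective = AP.surjective α
        }
      }

    fromDual : AD.Automorphism → AP.Automorphism
    fromDual α = record
      { to = AD.to α
      ; isOrderIsomorphism = record
        { isOrderMonomorphism = record
          { isOrderHomomorphism = record { cong = cong (AD.to α) ; mono = AD.mono α }
          ; injective = AD.injective α
          ; cancel = AD.cancel α
          }
        ; surjective = AD.surjective α
        }
      }

  dual-chiral : AP.Chiral → AD.Chiral
  dual-chiral ch with AP.Chiral.two-orbits ch
  ... | Φ₁ , Φ₂ , distinct , either = record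
    { two-orbits = reverseFlag Φ₁ , reverseFlag Φ₂ ,
        (λ (α , e) → distinct (fromDual α , λ i →
          trans (cong (AD.to α) (sym (opp-opp (P.face Φ₁) i))) (trans (e (opposite i)) (opp-opp (P.face Φ₂) i)))) ,
        λ Ψ → Sum.map (lift Φ₁ Ψ) (lift Φ₂ Ψ) (either (unreverse Ψ))
    ; adjacent-distinct = λ Φ Ψ adj (α , e) →
        AP.Chiral.adjacent-distinct ch (unreverse Φ) (unreverse Ψ) (unreverse-adjacent Φ Ψ adj)
          (fromDual α , λ i → e (opposite i))
    }
    where
    lift : ∀ Φ Ψ → AP.SameOrbit Φ (unreverse Ψ) → AD.SameOrbit (reverseFlag Φ) Ψ
    lift Φ Ψ (α , e) = toDual α , λ i → trans (e (opposite i)) (opp-opp (D.face Ψ) i)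

-- Chiral polytopes of rank n = suc m with a base flag.  (A polytope of rank 0
-- has a single flag, so it is never chiral.)
record ChiralPolytope (m : ℕ) : Set₁ where
  field
    polytope : Polytope (suc m)
  open Polytope polytope public
  open FlagExchange polytope public
  open Automorphisms polytope public
  field
    chiral   : Chiral
    baseFlag : Flag (suc m)

  same-orbit : ∀ i j → SameOrbit baseFlag (baseFlag ^ i ^ j)
  same-orbit i j = distinct-twice chiral baseFlag (baseFlag ^ i) (baseFlag ^ i ^ j) (step baseFlag i) (step (baseFlag ^ i) j)
    where
    step : ∀ Φ k → ¬ SameOrbit Φ (Φ ^ k)
    step Φ k = Chiral.adjacent-distinct chiral Φ (Φ ^ k) (position k , ^-adjacentAt Φ k)

  -- Generators are numbered from zero: `σ i` is σ_{i+1}, mapping the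
  -- base flag Φ to Φ^{i+1,i}.
  σ : Fin m → Automorphism
  σ i = proj₁ (same-orbit (suc i) (inject₁ i))

  σ-baseFlag : ∀ i → act (σ i) baseFlag ≈ baseFlag ^ suc i ^ inject₁ i
  σ-baseFlag i = proj₂ (same-orbit (suc i) (inject₁ i))

Finite : ∀ {m} → ChiralPolytope m → Set
Finite P = ∃ λ N → ChiralPolytope.Face P ↔ Fin N

mirror : ∀ {m} → ChiralPolytope m → ChiralPolytope m
mirror P = record { polytope = polytope ; chiral = chiral ; baseFlag = baseFlag ^ zero }
  where open ChiralPolytope P

infix 10 _ᵟ

_ᵟ : ∀ {m} → ChiralPolytope m → ChiralPolytope m
P ᵟ = record
  { polytope = dual polytope
  ; chiral = dual-chiral polytope chiral
  ; baseFlag = reverseFlag polytope baseFlag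
  }
  where open ChiralPolytope P

data Word (X : Set) : Set where
  gen : X → Word X
  ε   : Word X
  _∙_ : Word X → Word X → Word X
  _⁻¹ : Word X → Word X

infixl 7 _∙_
infix 8 _⁻¹

_>>=_ : ∀ {X Y} → Word X → (X → Word Y) → Word Y
gen x   >>= f = f x
ε       >>= f = ε
(u ∙ v) >>= f = (u >>= f) ∙ (v >>= f)
(u ⁻¹)  >>= f = (u >>= f) ⁻¹

mapWord : ∀ {X Y} → (X → Y) → Word X → Word Y
mapWord f w = w >>= (gen ∘ f)

module _ (G : Group 0ℓ 0ℓ) where
  private module G = Group G

  eval : ∀ {X} → (X → G.Carrier) → Word X → G.Carrier
  eval f (gen x) = f x
  eval f ε       = G.ε
  eval f (u ∙ v) = eval f u G.∙ eval f v
  eval f (u ⁻¹)  = eval f u G.⁻¹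

-- The least congruence on words making them a group in which the relators R
-- are trivial.
infix 4 _⊢_≈_

data _⊢_≈_ {X : Set} (R : Pred (Word X) 0ℓ) : Word X → Word X → Set where
  relator   : ∀ {w} → R w → R ⊢ w ≈ ε
  ≈-refl    : ∀ {u} → R ⊢ u ≈ u
  ≈-sym     : ∀ {u v} → R ⊢ u ≈ v → R ⊢ v ≈ u
  ≈-trans   : ∀ {u v w} → R ⊢ u ≈ v → R ⊢ v ≈ w → R ⊢ u ≈ w
  ∙-cong    : ∀ {u u′ v v′} → R ⊢ u ≈ u′ → R ⊢ v ≈ v′ → R ⊢ u ∙ v ≈ u′ ∙ v′
  ⁻¹-cong   : ∀ {u v} → R ⊢ u ≈ v → R ⊢ u ⁻¹ ≈ v ⁻¹
  assoc     : ∀ u v w → R ⊢ u ∙ v ∙ w ≈ u ∙ (v ∙ w)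
  identityˡ : ∀ u → R ⊢ ε ∙ u ≈ u
  identityʳ : ∀ u → R ⊢ u ∙ ε ≈ u
  inverseˡ  : ∀ u → R ⊢ u ⁻¹ ∙ u ≈ ε
  inverseʳ  : ∀ u → R ⊢ u ∙ u ⁻¹ ≈ ε

⟨_∣_⟩ : (X : Set) → Pred (Word X) 0ℓ → Group 0ℓ 0ℓ
⟨ X ∣ R ⟩ = record
  { Carrier = Word X
  ; _≈_ = R ⊢_≈_
  ; _∙_ = _∙_
  ; ε = ε
  ; _⁻¹ = _⁻¹
  ; isGroup = record
    { isMonoid = record
      { isSemigroup = record
        { isMagma = record
          { isEquivalence = record { refl = ≈-refl ; sym = ≈-sym ; trans = ≈-trans }
          ; ∙-cong = ∙-cong
          }
        ; assoc = assoc
        }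
      ; identity = identityˡ , identityʳ
      }
    ; inverse = inverseˡ , inverseʳ
    ; ⁻¹-cong = ⁻¹-cong
    }
  }

record GroupWithGenerators (k : ℕ) : Set₁ where
  field
    group     : Group 0ℓ 0ℓ
  open Group group public using (Carrier; _≈_) renaming (ε to 1#)
  field
    generator : Fin k → Carrier

  ⟦_⟧ : Word (Fin k) → Carrier
  ⟦_⟧ = eval group generator

  -- The words that are relations among the generators: the kernel of the map
  -- onto the group, and a set of defining relators for it.
  Kernel : Pred (Word (Fin k)) 0ℓ
  Kernel w = ⟦ w ⟧ ≈ 1#

Γ⁺ : ∀ {m} → ChiralPolytope m → GroupWithGenerators m
Γ⁺ P = record { group = Γ ; generator = σ }
  where open ChiralPolytope P

generatedSubgroup : ∀ {k} (G : Group 0ℓ 0ℓ) → (Fin k → Group.Carrier G) → GroupWithGenerators k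
generatedSubgroup G x = record
  { group = record
    { Carrier = Σ G.Carrier λ g → ∃ λ w → eval G x w G.≈ g
    ; _≈_ = λ g h → proj₁ g G.≈ proj₁ h
    ; _∙_ = λ { (g , u , p) (h , v , q) → g G.∙ h , u ∙ v , G.∙-cong p q }
    ; ε = G.ε , ε , G.refl
    ; _⁻¹ = λ { (g , u , p) → g G.⁻¹ , u ⁻¹ , G.⁻¹-cong p }
    ; isGroup = record
      { isMonoid = record
        { isSemigroup = record
          { isMagma = record
            { isEquivalence = record { refl = G.refl ; sym = G.sym ; trans = G.trans }
            ; ∙-cong = G.∙-cong
            }
          ; assoc = λ g h k → G.assoc (proj₁ g) (proj₁ h) (proj₁ k)
          }
        ; identity = (λ g → G.identityˡ (proj₁ g)) , (λ g → G.identityʳ (proj₁ g))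
        }
      ; inverse = (λ g → G.inverseˡ (proj₁ g)) , (λ g → G.inverseʳ (proj₁ g))
      ; ⁻¹-cong = G.⁻¹-cong
      }
    }
  ; generator = λ i → x i , gen i , G.refl
  }
  where module G = Group G

infix 9 _◇_ _□_

_◇_ : ∀ {k} → GroupWithGenerators k → GroupWithGenerators k → GroupWithGenerators k
G ◇ H = generatedSubgroup (DirectProduct.group G.group H.group) (λ i → G.generator i , H.generator i)
  where
  module G = GroupWithGenerators G
  module H = GroupWithGenerators H

data ComixRelator {k} (G H : GroupWithGenerators k) : Pred (Word (Fin k ⊎ Fin k)) 0ℓ where
  left     : ∀ {w} → GroupWithGenerators.Kernel G w → ComixRelator G H (mapWord inj₁ w)
  right    : ∀ {w} → GroupWithGenerators.Kernel H w → ComixRelator G H (mapWord inj₂ w)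
  identify : ∀ i → ComixRelator G H (gen (inj₁ i) ⁻¹ ∙ gen (inj₂ i))

_□_ : ∀ {k} → GroupWithGenerators k → GroupWithGenerators k → Group 0ℓ 0ℓ
_□_ {k} G H = ⟨ Fin k ⊎ Fin k ∣ ComixRelator G H ⟩

-- σᵢ⋯σⱼ
segment : ∀ {k} → Fin k → Fin k → Word (Fin k)
segment i j = foldr (λ l w → gen l ∙ w) ε (filter (λ l → i Finₚ.≤? l ×-dec l Finₚ.≤? j) (allFin _))

data W⁺-Relator {k} : Pred (Word (Fin k)) 0ℓ where
  square : ∀ {i j} → i Fin.< j → W⁺-Relator (segment i j ∙ segment i j)

-- W⁺ for rank k + 1, on the generators σ₁, …, σₖ.
W⁺ : ℕ → Group 0ℓ 0ℓ
W⁺ k = ⟨ Fin k ∣ W⁺-Relator ⟩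

bar : ∀ {k} → Word (Fin k) → Word (Fin k)
bar w = w >>= barGen
  where
  barGen : ∀ {k} → Fin k → Word (Fin k)
  barGen zero          = gen zero ⁻¹
  barGen (suc zero)    = gen zero ∙ gen zero ∙ gen (suc zero)
  barGen (suc (suc i)) = gen (suc (suc i))

-- The subset { w̄ : w ∈ N } of W⁺.
barImage : ∀ {k} → Pred (Word (Fin k)) 0ℓ → Pred (Word (Fin k)) 0ℓ
barImage {k} N w = ∃ λ v → N v × Group._≈_ (W⁺ k) w (bar v)

-- With Γ⁺(P) ◇ Γ⁺(Q) = W⁺/N: the pre-polytope P ◇ Q is chiral when N̄ ≠ N.
MixChiral : ∀ {m} → ChiralPolytope m → ChiralPolytope m → Set
MixChiral P Q = ¬ (barImage N ≐ N)
  where N = GroupWithGenerators.Kernel (Γ⁺ P ◇ Γ⁺ Q)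

HasCardinality : Group 0ℓ 0ℓ → ℕ → Set
HasCardinality G a = Inverse (setoid (Fin a)) (Group.setoid G)

module _ (G : Group 0ℓ 0ℓ) where
  open Group G renaming (ε to 1#) using (Carrier; _≈_; rawMonoid)
  open RawMonoid rawMonoid using () renaming (_×_ to _times_)

  record HasOrder (x : Carrier) (p : ℕ) : Set where
    field
      positive : 0 ℕ.< p
      power    : p times x ≈ 1#
      minimal  : ∀ q → 0 ℕ.< q → q times x ≈ 1# → p ℕ.≤ q

HasType : ∀ {m} → ChiralPolytope m → (Fin m → ℕ) → Set
HasType P p = ∀ i → HasOrder Γ (σ i) (p i)
  where open ChiralPolytope P

type-nonZero : ∀ {m} (P : ChiralPolytope m) {p} → HasType P p → ∀ i → NonZero (p i)
type-nonZero P type i = >-nonZero (HasOrder.positive (type i))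

-- lcm over i of ℓᵢ / pᵢ, where ℓᵢ = lcm(pᵢ, p_{n-i}).  Since p is indexed from
-- zero by Fin (n - 1), the index of p_{n-i} is the opposite of that of pᵢ.
ℓ : ∀ {m} (p : Fin m → ℕ) → (∀ i → NonZero (p i)) → ℕ
ℓ p nz = foldr lcm 1 (map (λ i → _/_ (lcm (p i) (p (opposite i))) (p i) {{nz i}}) (allFin _))

{-# OPTIONS --safe #-}
module Submission where

-- Write M, M̄ and δM for the kernels of the maps from the free group F on the
-- generators onto Γ⁺(P), Γ⁺(mirror P) and Γ⁺(P ᵟ), and put N = M ∩ δM and
-- K = M ∩ M̄.  If N̄ = N then N ⊆ M̄, so N ⊆ K.  Since |F/M M̄| = a and
-- |F/M δM| = b,
--   [F : M̄] = a [M : K]   and   [F : δM] = b [M : N] = b [M : K] [K : N].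
-- The two left-hand sides are equal (both are |Γ⁺(P)|; only [F : δM] ≤ [F : M̄]
-- is needed, and w ↦ bar (δ w) provides it), so b [K : N] ≤ a.  Each generator
-- has order pᵢ modulo M and modulo M̄, but order p_{n-i} modulo δM; so σᵢ^{pᵢ}
-- lies in K and has order ℓᵢ / pᵢ modulo N.  By Lagrange ℓ divides [K : N], and
-- ℓ b ≤ a.

open import Defs using (HasOrder)
open import Algebra.Bundles using (Group)
import Algebra.Construct.DirectProduct as DirectProduct
open import Algebra.Morphism.Structures using (module GroupMorphisms)
import Algebra.Properties.Group as GroupProperties
import Algebra.Properties.Monoid.Mult as Mult
open import Data.Fin.Base using (Fin; zero; suc; toℕ; fromℕ; fromℕ<; inject₁; opposite; combine; remQuot; funToFin; finToFun)
import Data.Fin.Base as Fin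
import Data.Fin.Properties as Finₚ
open import Data.Fin.Relation.Unary.Top using (view; ‵fromℕ; ‵inject₁)
open import Data.List.Base using (List; []; _∷_; [_]; _++_; length; lookup; map; foldr; filter; tabulate; reverse; allFin)
import Data.List.Membership.DecPropositional as DecMembership
open import Data.List.Membership.Propositional using (_∈_; _∉_)
open import Data.List.Membership.Propositional.Properties using (∈-allFin; ∈-map⁻; ∈-lookup)
open import Data.List.Properties using (length-map; filter-accept; filter-reject; filter-none; unfold-reverse)
open import Data.List.Relation.Unary.All as All using (All; []; _∷_)
import Data.List.Relation.Unary.All.Properties as Allₚ
open import Data.List.Relation.Unary.AllPairs as AllPairs using (AllPairs; []; _∷_)
import Data.List.Relation.Unary.AllPairs.Properties as AllPairsₚ
open import Data.List.Relation.Unary.Any using (here; there)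
open import Data.List.Relation.Unary.Unique.Propositional using (Unique)
open import Data.Nat.Base using (ℕ; zero; suc; _+_; _*_; _∸_; _%_; _/_; s≤s; z≤n; NonZero; >-nonZero)
import Data.Nat.Base as ℕ
open import Data.Nat.Divisibility using (_∣_; divides; ∣⇒≤; 1∣_; n∣m*n; m%n≡0⇒n∣m; _∣?_)
open import Data.Nat.DivMod using (m≡m%n+[m/n]*n; m%n<n; m/n*n≡m; m≥n⇒m/n>0; /-monoˡ-≤; m*n/n≡m)
open import Data.Nat.GCD using (gcd)
open import Data.Nat.LCM using (lcm; lcm-least; m∣lcm[m,n]; n∣lcm[m,n]; gcd*lcm)
import Data.Nat.Properties as ℕₚ
open import Data.Product.Base using (∃; _×_; _,_; proj₁; proj₂)
open import Data.Sum.Base using (_⊎_; inj₁; inj₂; reduce)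
import Data.Sum.Base as Sum
open import Function.Base using (_∘_; id)
open import Function.Bundles using (Inverse; _↔_)
open import Function.Properties.Inverse using (↔⇒↣)
open import Level using (0ℓ)
open import Relation.Binary.Bundles using (Setoid)
open import Relation.Binary.Construct.Closure.ReflexiveTransitive using (Star)
import Relation.Binary.Construct.Closure.ReflexiveTransitive as Star
open import Relation.Binary.Core using (Rel)
open import Relation.Binary.Definitions using (DecidableEquality)
open import Relation.Binary.PropositionalEquality as ≡ using (_≡_; _≢_; cong; cong₂; subst; subst₂)
open import Relation.Nullary using (¬_; Dec; yes; no; contradiction)
open import Relation.Nullary.Decidable using (decidable-stable; ¬¬-excluded-middle; _×-dec_)
open import Relation.Nullary.Negation using (DoubleNegation)
open import Relation.Unary using (Pred; _∩_; U; ∅)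

-- Cosets

-- Kernels are predicates on words, so all indices are taken in the free group. The hypothesis N̄ =
-- N, however, compares words only up to equality in W⁺; to draw N ⊆ M̄ from it, the relators of W⁺
-- must be shown to hold for the generators of the mirror image. These generators, like those of the
-- dual, are whatever automorphisms chirality provides, known only by their effect on one flag.
-- Every relation among them therefore rests on rigidity: automorphisms that agree on one flag agree
-- everywhere. Rigidity in turn requires each face to lie on a flag, which is recovered from the
-- common length of maximal chains. The indices [M : K] and [K : N] are not computed; they are shown
-- to exist up to double negation, which suffices because the inequality to be proved is decidable.

module Cosets (G : Group 0ℓ 0ℓ) where
  open Group G
  open GroupProperties G

  record IsSubgroup (H : Pred Carrier 0ℓ) : Set where
    field
      resp      : ∀ {x y} → x ≈ y → H x → H y
      ε-closed  : H ε
      ∙-closed  : ∀ {x y} → H x → H y → H (x ∙ y)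
      ⁻¹-closed : ∀ {x} → H x → H (x ⁻¹)

    \\-closed : ∀ {x y} → H x → H y → H (x \\ y)
    \\-closed x∈ y∈ = ∙-closed (⁻¹-closed x∈) y∈

    -- The relation x⁻¹y ∈ `H`, lying in one left coset, stands in for the quotient; this and the
    -- next two are its equivalence laws.
    coset-refl : ∀ x → H (x \\ x)
    coset-refl x = resp (sym (inverseˡ x)) ε-closed

    coset-sym : ∀ {x y} → H (x \\ y) → H (y \\ x)
    coset-sym {x} {y} h = resp (⁻¹-anti-homo-\\ x y) (⁻¹-closed h)

    coset-trans : ∀ {x y z} → H (x \\ y) → H (y \\ z) → H (x \\ z)
    coset-trans {x} {y} {z} h k = resp eq (∙-closed h k)
      where
      eq : (x \\ y) ∙ (y \\ z) ≈ x \\ z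
      eq = trans (assoc (x ⁻¹) y (y \\ z)) (∙-congˡ (\\-leftDividesˡ y z))

  open IsSubgroup

  ∩-isSubgroup : ∀ {H K} → IsSubgroup H → IsSubgroup K → IsSubgroup (H ∩ K)
  ∩-isSubgroup sH sK = record
    { resp = λ e (h , k) → resp sH e h , resp sK e k
    ; ε-closed = ε-closed sH , ε-closed sK
    ; ∙-closed = λ (h , k) (h′ , k′) → ∙-closed sH h h′ , ∙-closed sK k k′
    ; ⁻¹-closed = λ (h , k) → ⁻¹-closed sH h , ⁻¹-closed sK k
    }

  U-isSubgroup : IsSubgroup U
  U-isSubgroup = _

  ∙-\\ : ∀ x y z → (x ∙ y) \\ z ≈ y \\ (x \\ z)
  ∙-\\ x y z = trans (∙-congʳ (⁻¹-anti-homo-∙ x y)) (assoc (y ⁻¹) (x ⁻¹) z)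

  -- H need not lie in S: n is the index of S ∩ H in S.
  record HasIndex (S H : Pred Carrier 0ℓ) (n : ℕ) : Set where
    field
      rep       : Fin n → Carrier
      rep∈      : ∀ i → S (rep i)
      separated : ∀ i j → H (rep i \\ rep j) → i ≡ j
      covers    : ∀ x → S x → ∃ λ i → H (rep i \\ x)

  open HasIndex

  -- Each class is sent to the class of the image of its representative; since `f` reflects cosets,
  -- this is injective on `Fin n`.
  index-≤ : ∀ {S H T K n m} (f : Carrier → Carrier) → IsSubgroup K →
            (∀ {x} → S x → T (f x)) → (∀ x y → K (f x \\ f y) → H (x \\ y)) →
            HasIndex S H n → HasIndex T K m → n ℕ.≤ m
  index-≤ {K = K} {n = n} {m} f sK maps reflects s t = Finₚ.injective⇒≤ {f = class} injective
    where
    class : Fin n → Fin m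
    class i = proj₁ (covers t (f (rep s i)) (maps (rep∈ s i)))

    in-class : ∀ i → K (rep t (class i) \\ f (rep s i))
    in-class i = proj₂ (covers t (f (rep s i)) (maps (rep∈ s i)))

    injective : ∀ {i j} → class i ≡ class j → i ≡ j
    injective {i} {j} eq = separated s i j (reflects _ _ (coset-trans sK
      (coset-sym sK (in-class i))
      (subst (λ c → K (rep t c \\ f (rep s j))) (≡.sym eq) (in-class j))))

  index-unique : ∀ {S H n m} → IsSubgroup H → HasIndex S H n → HasIndex S H m → n ≡ m
  index-unique sH s t = ℕₚ.≤-antisym (index-≤ id sH id (λ _ _ → id) s t) (index-≤ id sH id (λ _ _ → id) t s)

  index-positive : ∀ {S H n} → IsSubgroup S → HasIndex S H n → 0 ℕ.< n
  index-positive {n = zero} sS s with covers s ε (ε-closed sS)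
  ... | () , _
  index-positive {n = suc _} sS s = ℕₚ.0<1+n

  -- The tower law fused with the second isomorphism theorem: by `lift`, `T` meets every coset of
  -- `K` in `S ∩ H`, so representatives for the lower step can be taken from `T`. This serves both
  -- for `T` equal to `S ∩ H` and for `H` a product of two kernels with `T` the first of them.
  index-* : ∀ {S H T K n m} → IsSubgroup S → IsSubgroup H → IsSubgroup K →
            (∀ x → T x → S x) → (∀ x → T x → H x) → (∀ x → S x → H x → ∃ λ y → T y × K (y \\ x)) →
            (∀ x → S x → K x → H x) →
            HasIndex S H n → HasIndex T K m → HasIndex S K (n * m)
  index-* {S} {H} {T} {K} {n} {m} sS sH sK T⊆S T⊆H lift K⊆H s t = record
    { rep = λ q → product (remQuot m q)
    ; rep∈ = λ q → product∈ (remQuot m q)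
    ; separated = λ q q′ h → ≡.trans (≡.sym (Finₚ.combine-remQuot {n} m q))
        (≡.trans (cong (λ (i , j) → combine i j) (product-separated (remQuot m q) (remQuot m q′) h))
          (Finₚ.combine-remQuot {n} m q′))
    ; covers = λ x x∈S → let (i , j) , h = product-covers x x∈S in
        combine i j , subst (λ q → K (product q \\ x)) (≡.sym (Finₚ.remQuot-combine i j)) h
    }
    where
    product : Fin n × Fin m → Carrier
    product (i , j) = rep s i ∙ rep t j

    product∈ : ∀ q → S (product q)
    product∈ (i , j) = ∙-closed sS (rep∈ s i) (T⊆S _ (rep∈ t j))

    rep~product : ∀ i j → H (rep s i \\ product (i , j))
    rep~product i j = resp sH (sym (\\-leftDividesʳ _ _)) (T⊆H _ (rep∈ t j))

    product-separated : ∀ q q′ → K (product q \\ product q′) → q ≡ q′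
    product-separated (i , j) (i′ , j′) h
      with separated s i i′ (coset-trans sH (rep~product i j) (coset-trans sH
             (K⊆H _ (\\-closed sS (product∈ (i , j)) (product∈ (i′ , j′))) h)
             (coset-sym sH (rep~product i′ j′))))
    ... | ≡.refl = cong (i ,_) (separated t j j′
      (resp sK (trans (∙-\\ _ _ _) (∙-congˡ (\\-leftDividesʳ _ _))) h))

    product-covers : ∀ x → S x → ∃ λ q → K (product q \\ x)
    product-covers x x∈S with covers s x x∈S
    ... | i , h with lift _ (\\-closed sS (rep∈ s i) x∈S) h
    ...   | y , y∈T , k with covers t y y∈T
    ...     | j , k′ = (i , j) , resp sK (sym (∙-\\ _ _ _)) (coset-trans sK k′ k)

  -- Without decidability of S and H an index cannot be computed; it only
  -- cannot fail to exist.
  index-exists : ∀ {S H q} → IsSubgroup H → (label : Carrier → Fin q) →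
                 (∀ x y → label x ≡ label y → H (x \\ y)) → DoubleNegation (∃ (HasIndex S H))
  index-exists {S} {H} {q} sH label same k = partial (allFin q) λ (n , s) → k (n , record
    { rep = rep s
    ; rep∈ = proj₁ ∘ rep∈ s
    ; separated = separated s
    ; covers = λ x x∈S → covers s x (x∈S , ∈-allFin (label x))
    })
    where
    Labelled : List (Fin q) → Pred Carrier 0ℓ
    Labelled ls x = S x × label x ∈ ls

    skip : ∀ {l ls n} (s : HasIndex (Labelled ls) H n) →
           (∀ x → S x → label x ≡ l → ∃ λ i → H (rep s i \\ x)) → HasIndex (Labelled (l ∷ ls)) H n
    skip s c = record
      { rep = rep s
      ; rep∈ = λ i → proj₁ (rep∈ s i) , there (proj₂ (rep∈ s i))
      ; separated = separated s
      ; covers = λ { x (x∈S , here e) → c x x∈S e ; x (x∈S , there l) → covers s x (x∈S , l) }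
      }

    add : ∀ {l ls n} (s : HasIndex (Labelled ls) H n) → ∀ y → S y → label y ≡ l →
          ¬ (∃ λ i → H (rep s i \\ y)) → HasIndex (Labelled (l ∷ ls)) H (suc n)
    add s y y∈S e new = record
      { rep = λ { zero → y ; (suc i) → rep s i }
      ; rep∈ = λ { zero → y∈S , here e ; (suc i) → proj₁ (rep∈ s i) , there (proj₂ (rep∈ s i)) }
      ; separated = λ
        { zero zero h → ≡.refl
        ; zero (suc j) h → contradiction (j , coset-sym sH h) new
        ; (suc i) zero h → contradiction (i , h) new
        ; (suc i) (suc j) h → cong suc (separated s i j h)
        }
      ; covers = λ
        { x (x∈S , here e′) → zero , same _ _ (≡.trans e (≡.sym e′))
        ; x (x∈S , there l) → let i , h = covers s x (x∈S , l) in suc i , h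
        }
      }

    partial : ∀ ls → DoubleNegation (∃ (HasIndex (Labelled ls) H))
    partial [] k = k (0 , record { rep = λ () ; rep∈ = λ () ; separated = λ () ; covers = λ { x (_ , ()) } })
    partial (l ∷ ls) k = partial ls λ (n , s) →
      ¬¬-excluded-middle {A = ∃ λ y → S y × label y ≡ l} λ
        { (no none) → k (n , skip s λ x x∈S e → contradiction (x , x∈S , e) none)
        ; (yes (y , y∈S , e)) → ¬¬-excluded-middle {A = ∃ λ i → H (rep s i \\ y)} λ
          { (yes (i , h)) → k (n , skip s λ x x∈S e′ → i , coset-trans sH h (same _ _ (≡.trans e (≡.sym e′))))
          ; (no new) → k (suc n , add s y y∈S e new)
          }
        }

-- Orders of elements

module Orders (G : Group 0ℓ 0ℓ) where
  open Group G
  open GroupProperties G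
  open Mult monoid using (×-homo-+; ×-assocˡ; ×-congˡ; ×-congʳ) renaming (_×_ to _times_) public
  open import Relation.Binary.Reasoning.Setoid setoid

  times-ε : ∀ n → n times ε ≈ ε
  times-ε zero    = refl
  times-ε (suc n) = trans (identityˡ _) (times-ε n)

  times-∣ : ∀ {x p n} → p ∣ n → p times x ≈ ε → n times x ≈ ε
  times-∣ {x} {p} (divides n ≡.refl) e = trans (sym (×-assocˡ x n p)) (trans (×-congʳ n e) (times-ε n))

  times-% : ∀ {x p} .{{_ : NonZero p}} → p times x ≈ ε → ∀ n → (n % p) times x ≈ n times x
  times-% {x} {p} e n = begin
    (n % p) times x                              ≈⟨ identityʳ _ ⟨
    (n % p) times x ∙ ε                          ≈⟨ ∙-congˡ (times-∣ (n∣m*n (n / p)) e) ⟨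
    (n % p) times x ∙ ((n / p) * p) times x      ≈⟨ ×-homo-+ x (n % p) ((n / p) * p) ⟨
    (n % p + (n / p) * p) times x                ≡⟨ cong (_times x) (m≡m%n+[m/n]*n n p) ⟨
    n times x                                    ∎

  order-∣ : ∀ {x p} → HasOrder G x p → ∀ n → n times x ≈ ε → p ∣ n
  order-∣ {x} {p} o n e = m%n≡0⇒n∣m n p (remainder (n % p) ≡.refl)
    where
    open HasOrder o
    instance
      p≢0 : NonZero p
      p≢0 = >-nonZero positive
    remainder : ∀ r → n % p ≡ r → r ≡ 0
    remainder zero    _  = ≡.refl
    remainder (suc r) eq = contradiction
      (minimal (suc r) ℕₚ.0<1+n (≡.subst (λ k → k times x ≈ ε) eq (trans (times-% power n) e)))
      (ℕₚ.<⇒≱ (≡.subst (ℕ._< p) eq (m%n<n n p)))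

  times-injective-≤ : ∀ {x p i j} → HasOrder G x p → i ℕ.≤ j → j ℕ.< p → i times x ≈ j times x → i ≡ j
  times-injective-≤ {x} {p} {i} {j} o i≤j j<p e = ℕₚ.≤-antisym i≤j (ℕₚ.m∸n≡0⇒m≤n (small (j ∸ i) ≡.refl))
    where
    difference : (j ∸ i) times x ≈ ε
    difference = ∙-cancelˡ (i times x) _ _ (begin
      i times x ∙ (j ∸ i) times x  ≈⟨ ×-homo-+ x i (j ∸ i) ⟨
      (i + (j ∸ i)) times x        ≡⟨ cong (_times x) (ℕₚ.m+[n∸m]≡n i≤j) ⟩
      j times x                    ≈⟨ e ⟨
      i times x                    ≈⟨ identityʳ _ ⟨
      i times x ∙ ε                ∎)

    small : ∀ d → j ∸ i ≡ d → d ≡ 0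
    small zero    _  = ≡.refl
    small (suc d) eq = contradiction
      (HasOrder.minimal o (suc d) ℕₚ.0<1+n (≡.subst (λ k → k times x ≈ ε) eq difference))
      (ℕₚ.<⇒≱ (ℕₚ.≤-<-trans (≡.subst (ℕ._≤ j) eq (ℕₚ.m∸n≤m j i)) j<p))

  times-injective : ∀ {x p i j} → HasOrder G x p → i ℕ.< p → j ℕ.< p → i times x ≈ j times x → i ≡ j
  times-injective {i = i} {j} o i<p j<p e with ℕₚ.≤-total i j
  ... | inj₁ i≤j = times-injective-≤ o i≤j j<p e
  ... | inj₂ j≤i = ≡.sym (times-injective-≤ o j≤i i<p (sym e))

  times-⁻¹ : ∀ x n → n times x ≈ ε → n times (x ⁻¹) ≈ ε
  times-⁻¹ x n e = trans (commute n) (trans (⁻¹-cong e) ε⁻¹≈ε)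
    where
    commute : ∀ n → n times (x ⁻¹) ≈ (n times x) ⁻¹
    commute zero    = sym ε⁻¹≈ε
    commute (suc n) = begin
      x ⁻¹ ∙ n times (x ⁻¹)       ≈⟨ ∙-congˡ (commute n) ⟩
      x ⁻¹ ∙ (n times x) ⁻¹       ≈⟨ ⁻¹-anti-homo-∙ (n times x) x ⟨
      (n times x ∙ x) ⁻¹          ≈⟨ ⁻¹-cong (∙-congˡ (identityʳ x)) ⟨
      (n times x ∙ 1 times x) ⁻¹  ≈⟨ ⁻¹-cong (×-homo-+ x n 1) ⟨
      ((n + 1) times x) ⁻¹        ≡⟨ cong (λ k → (k times x) ⁻¹) (ℕₚ.+-comm n 1) ⟩
      (suc n times x) ⁻¹          ∎

  times-conjugate : ∀ g x n → n times x ≈ ε → n times (g ∙ x ∙ g ⁻¹) ≈ ε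
  times-conjugate g x n e = trans (commute n) (trans (∙-congʳ (trans (∙-congˡ e) (identityʳ g))) (inverseʳ g))
    where
    commute : ∀ n → n times (g ∙ x ∙ g ⁻¹) ≈ g ∙ n times x ∙ g ⁻¹
    commute zero    = sym (trans (∙-congʳ (identityʳ g)) (inverseʳ g))
    commute (suc n) = begin
      g ∙ x ∙ g ⁻¹ ∙ n times (g ∙ x ∙ g ⁻¹)      ≈⟨ ∙-congˡ (commute n) ⟩
      g ∙ x ∙ g ⁻¹ ∙ (g ∙ n times x ∙ g ⁻¹)      ≈⟨ assoc _ _ _ ⟨
      g ∙ x ∙ g ⁻¹ ∙ (g ∙ n times x) ∙ g ⁻¹      ≈⟨ ∙-congʳ (assoc _ _ _) ⟩
      g ∙ x ∙ (g \\ (g ∙ n times x)) ∙ g ⁻¹      ≈⟨ ∙-congʳ (∙-congˡ (\\-leftDividesʳ g (n times x))) ⟩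
      g ∙ x ∙ n times x ∙ g ⁻¹                   ≈⟨ ∙-congʳ (assoc _ _ _) ⟩
      g ∙ (x ∙ n times x) ∙ g ⁻¹                 ∎

  order-resp : ∀ {x y p} → x ≈ y → HasOrder G x p → HasOrder G y p
  order-resp {p = p} e o = record
    { positive = positive
    ; power = trans (×-congʳ p (sym e)) power
    ; minimal = λ q 0<q h → minimal q 0<q (trans (×-congʳ q e) h)
    }
    where open HasOrder o

  -- The r-th power of `p times x` is trivial exactly when r * p is a multiple of q, hence a common
  -- multiple of p and q; the least such r is `lcm p q / p`. This is the origin of ℓᵢ / pᵢ.
  order-times : ∀ {x q} p .{{_ : NonZero p}} → HasOrder G x q → HasOrder G (p times x) (lcm p q / p)
  order-times {x} {q} p o = record
    { positive = m≥n⇒m/n>0 (∣⇒≤ {{lcm≢0}} p∣lcm)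
    ; power = begin
        (lcm p q / p) times (p times x)   ≈⟨ ×-assocˡ x (lcm p q / p) p ⟩
        (lcm p q / p * p) times x         ≡⟨ cong (_times x) (m/n*n≡m p∣lcm) ⟩
        lcm p q times x                   ≈⟨ times-∣ (n∣lcm[m,n] p q) (HasOrder.power o) ⟩
        ε                                 ∎
    ; minimal = λ r 0<r h → ℕₚ.≤-trans
        (/-monoˡ-≤ p (∣⇒≤ {{ℕₚ.m*n≢0 r p {{>-nonZero 0<r}}}}
          (lcm-least (n∣m*n r) (order-∣ o (r * p) (trans (sym (×-assocˡ x r p)) h)))))
        (ℕₚ.≤-reflexive (m*n/n≡m r p))
    }
    where
    p∣lcm : p ∣ lcm p q
    p∣lcm = m∣lcm[m,n] p q

    lcm≢0 : NonZero (lcm p q)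
    lcm≢0 = ℕ.≢-nonZero λ e → Sum.[ ℕ.≢-nonZero⁻¹ p , ℕ.≢-nonZero⁻¹ q {{>-nonZero (HasOrder.positive o)}} ]
      (ℕₚ.m*n≡0⇒m≡0∨n≡0 p (≡.trans (≡.sym (gcd*lcm p q)) (≡.trans (cong (gcd p q *_) e) (ℕₚ.*-zeroʳ (gcd p q)))))

  -- Makes the natural powers of an element of finite order closed under inverses: for order
  -- `suc p`, the exponent `p * j` complements `j` to a multiple of the order.
  powers-⁻¹ : ∀ {x p} → HasOrder G x p → ∀ j → ∃ λ k → (j times x) ⁻¹ ≈ k times x
  powers-⁻¹ {x} {suc p} o j = p * j , sym (inverseʳ-unique _ _ (begin
    j times x ∙ (p * j) times x  ≈⟨ ×-homo-+ x j (p * j) ⟨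
    (suc p * j) times x          ≡⟨ cong (_times x) (ℕₚ.*-comm (suc p) j) ⟩
    (j * suc p) times x          ≈⟨ times-∣ (n∣m*n j) (HasOrder.power o) ⟩
    ε                            ∎))
  powers-⁻¹ {x} {zero} o j = contradiction (HasOrder.positive o) λ ()

-- Kernels of homomorphisms and Lagrange's theorem

module Homomorphism (G K : Group 0ℓ 0ℓ) where
  private
    module G = Group G
    module K = Group K
  open GroupMorphisms G.rawGroup K.rawGroup using (IsGroupHomomorphism)
  open Cosets G
  open Orders K

  preimage-isSubgroup : ∀ {f H} → IsGroupHomomorphism f → Cosets.IsSubgroup K H → IsSubgroup (H ∘ f)
  preimage-isSubgroup hom sH = record
    { resp = λ e → resp (⟦⟧-cong e)
    ; ε-closed = resp (K.sym ε-homo) ε-closed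
    ; ∙-closed = λ h k → resp (K.sym (homo _ _)) (∙-closed h k)
    ; ⁻¹-closed = λ h → resp (K.sym (⁻¹-homo _)) (⁻¹-closed h)
    }
    where
    open IsGroupHomomorphism hom
    open Cosets.IsSubgroup sH

  Ker : (G.Carrier → K.Carrier) → Pred G.Carrier 0ℓ
  Ker f x = f x K.≈ K.ε

  Ker-isSubgroup : ∀ {f} → IsGroupHomomorphism f → IsSubgroup (Ker f)
  Ker-isSubgroup hom = preimage-isSubgroup hom record
    { resp = λ e h → K.trans (K.sym e) h
    ; ε-closed = K.refl
    ; ∙-closed = λ h k → K.trans (K.∙-cong h k) (K.identityˡ K.ε)
    ; ⁻¹-closed = λ h → K.trans (K.⁻¹-cong h) (GroupProperties.ε⁻¹≈ε K)
    }

  Ker-\\⁻ : ∀ {f} → IsGroupHomomorphism f → ∀ x y → Ker f (x G.\\ y) → f x K.≈ f y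
  Ker-\\⁻ {f} hom x y e = K.sym (K.trans
    (GroupProperties.inverseʳ-unique K _ _ (K.trans (K.sym (K.trans (homo _ _) (K.∙-congʳ (⁻¹-homo x)))) e))
    (GroupProperties.⁻¹-involutive K (f x)))
    where open IsGroupHomomorphism hom

  Ker-\\⁺ : ∀ {f} → IsGroupHomomorphism f → ∀ x y → f x K.≈ f y → Ker f (x G.\\ y)
  Ker-\\⁺ {f} hom x y e = K.trans (homo _ _) (K.trans (K.∙-cong (⁻¹-homo x) (K.sym e)) (K.inverseˡ (f x)))
    where open IsGroupHomomorphism hom

  homo-times : ∀ {f} → IsGroupHomomorphism f → ∀ n x → f (Orders._times_ G n x) K.≈ n times f x
  homo-times hom zero    x = IsGroupHomomorphism.ε-homo hom
  homo-times hom (suc n) x = K.trans (IsGroupHomomorphism.homo hom _ _) (K.∙-congˡ (homo-times hom n x))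

  -- The elements of `S` whose image is a power of `f x` form an intermediate subgroup, of index `o`
  -- over the kernel, so the tower law makes `o` a factor of `c`. The other factor exists up to
  -- double negation, and divisibility is decidable.
  order-∣-index : ∀ {f S q c o x} → IsGroupHomomorphism f → IsSubgroup S →
                  (label : K.Carrier → Fin q) → (∀ {x y} → label x ≡ label y → x K.≈ y) →
                  S x → HasOrder K (f x) o → HasIndex S (Ker f) c → o ∣ c
  order-∣-index {f} {S} {q} {c} {o} {x} hom sS label faithful x∈S order s =
    decidable-stable (o ∣? c) λ o∤c →
      index-exists {S = S} {H = Powers} sP (label ∘ f)
        (λ y z e → 0 , Ker-\\⁺ hom y z (faithful e))
        λ (d , t) → o∤c (divides d (index-unique sK s
          (index-* sS sP sK (λ _ → proj₁) (λ _ → proj₂) (λ y y∈S y∈P → y , (y∈S , y∈P) , IsSubgroup.coset-refl sK y)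
            (λ _ _ e → 0 , e) t cyclic)))
    where
    open HasOrder order
    instance
      o≢0 : NonZero o
      o≢0 = >-nonZero positive

    sK : IsSubgroup (Ker f)
    sK = Ker-isSubgroup hom

    Powers : Pred G.Carrier 0ℓ
    Powers y = ∃ λ j → f y K.≈ j times f x

    sP : IsSubgroup Powers
    sP = preimage-isSubgroup {H = λ y → ∃ λ j → y K.≈ j times f x} hom record
      { resp = λ e (j , h) → j , K.trans (K.sym e) h
      ; ε-closed = 0 , K.refl
      ; ∙-closed = λ (i , h) (j , k) → i + j , K.trans (K.∙-cong h k) (K.sym (×-homo-+ (f x) i j))
      ; ⁻¹-closed = λ (j , h) → let k , e = powers-⁻¹ order j in k , K.trans (K.⁻¹-cong h) e
      }

    power∈S : ∀ n → S (Orders._times_ G n x)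
    power∈S zero    = IsSubgroup.ε-closed sS
    power∈S (suc n) = IsSubgroup.∙-closed sS x∈S (power∈S n)

    cyclic : HasIndex (S ∩ Powers) (Ker f) o
    cyclic = record
      { rep = λ i → Orders._times_ G (toℕ i) x
      ; rep∈ = λ i → power∈S (toℕ i) , toℕ i , homo-times hom (toℕ i) x
      ; separated = λ i j h → Finₚ.toℕ-injective (times-injective order (Finₚ.toℕ<n i) (Finₚ.toℕ<n j)
          (K.trans (K.sym (homo-times hom (toℕ i) x)) (K.trans (Ker-\\⁻ hom _ _ h) (homo-times hom (toℕ j) x))))
      ; covers = λ y (_ , j , e) → fromℕ< (m%n<n j o) , Ker-\\⁺ hom _ _ (K.trans
          (homo-times hom (toℕ (fromℕ< (m%n<n j o))) x) (K.trans
          (K.reflexive (cong (_times f x) (Finₚ.toℕ-fromℕ< (m%n<n j o)))) (K.trans (times-% power j) (K.sym e))))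
      }

open import Defs

-- Words

module _ (G : Group 0ℓ 0ℓ) where
  private module G = Group G

  eval-cong : ∀ {X} {f g : X → G.Carrier} → (∀ x → f x G.≈ g x) → ∀ w → eval G f w G.≈ eval G g w
  eval-cong e (gen x) = e x
  eval-cong e ε       = G.refl
  eval-cong e (u ∙ v) = G.∙-cong (eval-cong e u) (eval-cong e v)
  eval-cong e (u ⁻¹)  = G.⁻¹-cong (eval-cong e u)

  eval->>= : ∀ {X Y} (f : Y → G.Carrier) (g : X → Word Y) w → eval G f (w >>= g) ≡ eval G (eval G f ∘ g) w
  eval->>= f g (gen x) = ≡.refl
  eval->>= f g ε       = ≡.refl
  eval->>= f g (u ∙ v) = cong₂ G._∙_ (eval->>= f g u) (eval->>= f g v)
  eval->>= f g (u ⁻¹)  = cong G._⁻¹ (eval->>= f g u)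

  eval-respects : ∀ {X} {R : Pred (Word X) 0ℓ} (f : X → G.Carrier) → (∀ {w} → R w → eval G f w G.≈ G.ε) →
                  ∀ {u v} → R ⊢ u ≈ v → eval G f u G.≈ eval G f v
  eval-respects f h (relator r)     = h r
  eval-respects f h ≈-refl          = G.refl
  eval-respects f h (≈-sym d)       = G.sym (eval-respects f h d)
  eval-respects f h (≈-trans d d′)  = G.trans (eval-respects f h d) (eval-respects f h d′)
  eval-respects f h (∙-cong d d′)   = G.∙-cong (eval-respects f h d) (eval-respects f h d′)
  eval-respects f h (⁻¹-cong d)     = G.⁻¹-cong (eval-respects f h d)
  eval-respects f h (assoc u v w)   = G.assoc _ _ _
  eval-respects f h (identityˡ u)   = G.identityˡ _
  eval-respects f h (identityʳ u)   = G.identityʳ _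
  eval-respects f h (inverseˡ u)    = G.inverseˡ _
  eval-respects f h (inverseʳ u)    = G.inverseʳ _

eval-presented : ∀ {X Y} {R : Pred (Word Y) 0ℓ} (f : X → Word Y) w → eval ⟨ Y ∣ R ⟩ f w ≡ (w >>= f)
eval-presented f (gen x) = ≡.refl
eval-presented f ε       = ≡.refl
eval-presented f (u ∙ v) = cong₂ _∙_ (eval-presented f u) (eval-presented f v)
eval-presented f (u ⁻¹)  = cong _⁻¹ (eval-presented f u)

mapWord-id : ∀ {X} (w : Word X) → mapWord id w ≡ w
mapWord-id (gen x) = ≡.refl
mapWord-id ε       = ≡.refl
mapWord-id (u ∙ v) = cong₂ _∙_ (mapWord-id u) (mapWord-id v)
mapWord-id (u ⁻¹)  = cong _⁻¹ (mapWord-id u)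

Free : ℕ → Group 0ℓ 0ℓ
Free k = ⟨ Fin k ∣ ∅ ⟩

eval-homomorphism : ∀ {k} (G : Group 0ℓ 0ℓ) (f : Fin k → Group.Carrier G) →
  GroupMorphisms.IsGroupHomomorphism (Group.rawGroup (Free k)) (Group.rawGroup G) (eval G f)
eval-homomorphism G f = record
  { isMonoidHomomorphism = record
    { isMagmaHomomorphism = record
      { isRelHomomorphism = record { cong = eval-respects G f λ () }
      ; homo = λ _ _ → G.refl
      }
    ; ε-homo = G.refl
    }
  ; ⁻¹-homo = λ _ → G.refl
  }
  where module G = Group G

-- The comix

module Comix {k} (G H : GroupWithGenerators k) where
  private
    module G = GroupWithGenerators G
    module GG = Group G.group
    module H = GroupWithGenerators H
    module HH = Group H.group
    module C = Group (G □ H)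
  open Cosets (Free k)

  comix : Word (Fin k) → Word (Fin k ⊎ Fin k)
  comix = eval (G □ H) (gen ∘ inj₁)

  -- This is the product of the two kernels: `Kernel⊆ˡ` and `Kernel⊆ʳ` give one inclusion,
  -- `ComixKernel-product` the other.
  ComixKernel : Pred (Word (Fin k)) 0ℓ
  ComixKernel w = comix w C.≈ ε

  ComixKernel-isSubgroup : IsSubgroup ComixKernel
  ComixKernel-isSubgroup = Homomorphism.Ker-isSubgroup (Free k) (G □ H) (eval-homomorphism (G □ H) (gen ∘ inj₁))

  Kernel⊆ˡ : ∀ w → G.Kernel w → ComixKernel w
  Kernel⊆ˡ w e = C.trans (C.reflexive (eval-presented (gen ∘ inj₁) w)) (relator (left {w = w} e))

  inj₁≈inj₂ : ∀ i → gen (inj₁ i) C.≈ gen (inj₂ i)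
  inj₁≈inj₂ i = C.sym (C.trans (inverseʳ-unique _ _ (relator (identify i))) (⁻¹-involutive _))
    where open GroupProperties (G □ H)

  Kernel⊆ʳ : ∀ w → H.Kernel w → ComixKernel w
  Kernel⊆ʳ w e = C.trans (eval-cong (G □ H) inj₁≈inj₂ w)
    (C.trans (C.reflexive (eval-presented (gen ∘ inj₂) w)) (relator (right {w = w} e)))

  collapse : Word (Fin k ⊎ Fin k) → Word (Fin k)
  collapse = mapWord reduce

  -- Provides a section of `comix`, so that the cardinality of the comix is the index of
  -- `ComixKernel`.
  comix-collapse : ∀ u → comix (collapse u) C.≈ u
  comix-collapse u = C.trans (C.reflexive (eval->>= (G □ H) (gen ∘ inj₁) (gen ∘ reduce) u))
    (C.trans (eval-cong (G □ H) same u)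
      (C.reflexive (≡.trans (eval-presented gen u) (mapWord-id u))))
    where
    same : ∀ x → gen (inj₁ (reduce x)) C.≈ gen x
    same (inj₁ i) = C.refl
    same (inj₂ i) = inj₁≈inj₂ i

  comix-index : ∀ {a} → HasCardinality (G □ H) a → HasIndex U ComixKernel a
  comix-index card = record
    { rep = λ i → collapse (to i)
    ; rep∈ = λ _ → _
    ; separated = λ i j h → ≡.trans (≡.sym (strictlyInverseʳ i)) (Inverse.inverseʳ card (C.trans
        (C.sym (comix-collapse (to i))) (C.trans (Ker-\\⁻ hom (collapse (to i)) (collapse (to j)) h) (comix-collapse (to j)))))
    ; covers = λ x _ → from (comix x) ,
        Ker-\\⁺ hom (collapse (to (from (comix x)))) x (C.trans (comix-collapse _) (strictlyInverseˡ (comix x)))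
    }
    where
    open Inverse card using (to; from; strictlyInverseˡ; strictlyInverseʳ)
    open Homomorphism (Free k) (G □ H)
    hom = eval-homomorphism (G □ H) (gen ∘ inj₁)

  -- Agreement of the collapsed words in the quotient of `H` by the image of the kernel of `G`,
  -- expressed without forming that quotient. It is an invariant of derivations in the comix, proved
  -- by induction on them.
  Differ : Word (Fin k ⊎ Fin k) → Word (Fin k ⊎ Fin k) → Set
  Differ u v = ∃ λ m → G.Kernel m × H.⟦ collapse u ⟧ HH.≈ H.⟦ collapse v ⟧ HH.∙ H.⟦ m ⟧

  differ-≈ : ∀ {u v} → H.⟦ collapse u ⟧ HH.≈ H.⟦ collapse v ⟧ → Differ u v
  differ-≈ e = ε , GG.refl , HH.trans e (HH.sym (HH.identityʳ _))

  conjugate-kernel : ∀ m v → G.Kernel m → G.Kernel (v ⁻¹ ∙ (m ∙ v))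
  conjugate-kernel m v e = GG.trans (GG.∙-congˡ (GG.trans (GG.∙-congʳ e) (GG.identityˡ _))) (GG.inverseˡ _)

  collapse-map : (inj : Fin k → Fin k ⊎ Fin k) → (∀ i → reduce (inj i) ≡ i) → ∀ w → H.⟦ collapse (mapWord inj w) ⟧ HH.≈ H.⟦ w ⟧
  collapse-map inj e w = HH.trans (HH.reflexive (eval->>= H.group H.generator (gen ∘ reduce) (mapWord inj w)))
    (HH.trans (HH.reflexive (eval->>= H.group (H.generator ∘ reduce) (gen ∘ inj) w))
      (eval-cong H.group (λ i → HH.reflexive (cong H.generator (e i))) w))

  differ : ∀ {u v} → ComixRelator G H ⊢ u ≈ v → Differ u v
  differ (relator (left {w} e))  = w , e , HH.trans (collapse-map inj₁ (λ _ → ≡.refl) w) (HH.sym (HH.identityˡ _))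
  differ (relator (right {w} e)) = differ-≈ {mapWord inj₂ w} {ε} (HH.trans (collapse-map inj₂ (λ _ → ≡.refl) w) e)
  differ (relator (identify i))  = differ-≈ {gen (inj₁ i) ⁻¹ ∙ gen (inj₂ i)} {ε} (HH.inverseˡ _)
  differ {u} {v} ≈-refl          = differ-≈ {u} {v} HH.refl
  differ {u} {v} (≈-sym d) with differ d
  ... | m , e , h = m ⁻¹ , GG.trans (GG.⁻¹-cong e) (GroupProperties.ε⁻¹≈ε G.group) ,
    GroupProperties.x≈z//y H.group _ _ _ (HH.sym h)
  differ {u} {v} (≈-trans d d′) with differ d | differ d′
  ... | m , e , h | m′ , e′ , h′ = m′ ∙ m , GG.trans (GG.∙-cong e′ e) (GG.identityˡ _) ,
    HH.trans h (HH.trans (HH.∙-congʳ h′) (HH.assoc _ _ _))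
  differ (∙-cong {u} {u′} {v} {v′} d d′) with differ d | differ d′
  -- In x n y n′ the factor n moves to the right past y at the price of conjugation by y; the kernel
  -- of `G` is normal, so it absorbs the conjugate.
  ... | m , e , h | m′ , e′ , h′ = (collapse v′ ⁻¹ ∙ (m ∙ collapse v′)) ∙ m′ ,
    GG.trans (GG.∙-cong (conjugate-kernel m (collapse v′) e) e′) (GG.identityˡ _) ,
    (begin
      a ∙ᴴ b                                    ≈⟨ HH.∙-cong h h′ ⟩
      (x ∙ᴴ n) ∙ᴴ (y ∙ᴴ n′)                     ≈⟨ HH.assoc _ _ _ ⟨
      (x ∙ᴴ n) ∙ᴴ y ∙ᴴ n′                       ≈⟨ HH.∙-congʳ (HH.assoc _ _ _) ⟩
      x ∙ᴴ (n ∙ᴴ y) ∙ᴴ n′                       ≈⟨ HH.∙-congʳ (HH.∙-congˡ (GroupProperties.\\-leftDividesˡ H.group y (n ∙ᴴ y))) ⟨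
      x ∙ᴴ (y ∙ᴴ (y HH.\\ (n ∙ᴴ y))) ∙ᴴ n′      ≈⟨ HH.∙-congʳ (HH.assoc _ _ _) ⟨
      x ∙ᴴ y ∙ᴴ (y HH.\\ (n ∙ᴴ y)) ∙ᴴ n′        ≈⟨ HH.assoc _ _ _ ⟩
      x ∙ᴴ y ∙ᴴ ((y HH.\\ (n ∙ᴴ y)) ∙ᴴ n′)      ∎)
    where
    open import Relation.Binary.Reasoning.Setoid HH.setoid
    infixl 7 _∙ᴴ_
    _∙ᴴ_ = HH._∙_
    a = H.⟦ collapse u ⟧
    b = H.⟦ collapse v ⟧
    x = H.⟦ collapse u′ ⟧
    y = H.⟦ collapse v′ ⟧
    n = H.⟦ m ⟧
    n′ = H.⟦ m′ ⟧
  differ (⁻¹-cong {u} {v} d) with differ d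
  ... | m , e , h = collapse v ⁻¹ ⁻¹ ∙ (m ⁻¹ ∙ collapse v ⁻¹) ,
    conjugate-kernel (m ⁻¹) (collapse v ⁻¹) (GG.trans (GG.⁻¹-cong e) (GroupProperties.ε⁻¹≈ε G.group)) ,
    HH.trans (HH.⁻¹-cong h) (HH.trans (⁻¹-anti-homo-∙ _ _) (HH.sym (\\-leftDividesˡ _ _)))
    where open GroupProperties H.group
  differ (assoc u v w)           = differ-≈ {u ∙ v ∙ w} {u ∙ (v ∙ w)} (HH.assoc _ _ _)
  differ (identityˡ u)           = differ-≈ {ε ∙ u} {u} (HH.identityˡ _)
  differ (identityʳ u)           = differ-≈ {u ∙ ε} {u} (HH.identityʳ _)
  differ (inverseˡ u)            = differ-≈ {u ⁻¹ ∙ u} {ε} (HH.inverseˡ _)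
  differ (inverseʳ u)            = differ-≈ {u ∙ u ⁻¹} {ε} (HH.inverseʳ _)

  -- A word trivial in the comix agrees in `H` with some `m` from the kernel of `G`, by `differ`;
  -- hence w = m (m⁻¹ w) factors through both kernels. This is the `lift` that `index-*` asks for.
  ComixKernel-product : ∀ w → ComixKernel w → ∃ λ m → G.Kernel m × H.Kernel (m ⁻¹ ∙ w)
  ComixKernel-product w e with differ (C.trans (C.reflexive (≡.sym (eval-presented (gen ∘ inj₁) w))) e)
  ... | m , m∈ , h = m , m∈ , HH.trans
    (HH.∙-congˡ (HH.trans (HH.sym (collapse-map inj₁ (λ _ → ≡.refl) w)) (HH.trans h (HH.identityˡ _)))) (HH.inverseˡ _)

-- The index inequality

foldr-lcm-∣ : ∀ {A : Set} (f : A → ℕ) {c} → (∀ x → f x ∣ c) → ∀ xs → foldr lcm 1 (map f xs) ∣ c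
foldr-lcm-∣ f {c} h []       = 1∣ c
foldr-lcm-∣ f     h (x ∷ xs) = lcm-least (h x) (foldr-lcm-∣ f h xs)

-- Finiteness as separation by finitely many labels, which bounds the number of cosets with no
-- enumeration of the group.
FaithfulLabel : Group 0ℓ 0ℓ → Set
FaithfulLabel G = ∃ λ q → ∃ λ (label : Carrier → Fin q) → ∀ {x y} → label x ≡ label y → x ≈ y
  where open Group G

module _ {k} (G A B : GroupWithGenerators k) where
  private
    module G = GroupWithGenerators G
    module A = GroupWithGenerators A
    module B = GroupWithGenerators B
    module FA = Homomorphism (Free k) A.group
    module FB = Homomorphism (Free k) B.group
  open Cosets (Free k)

  -- The group theory of the argument, free of polytopes: `G`, `A`, `B` will be the groups of P, its
  -- mirror image and its dual, with `f` the map w ↦ `bar (delta w)`, `x i` the power of a generator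
  -- by its order and `o i` the number ℓᵢ / pᵢ.
  comix-bound : FaithfulLabel A.group → FaithfulLabel B.group →
    (∀ w → G.Kernel w → B.Kernel w → A.Kernel w) →
    (f : Word (Fin k) → Word (Fin k)) → (∀ u v → A.⟦ f u ⟧ A.≈ A.⟦ f v ⟧ → B.⟦ u ⟧ B.≈ B.⟦ v ⟧) →
    (x : Fin k → Word (Fin k)) → (∀ i → G.Kernel (x i)) → (∀ i → A.Kernel (x i)) →
    (o : Fin k → ℕ) → (∀ i → HasOrder B.group B.⟦ x i ⟧ (o i)) →
    ∀ {a b} → HasCardinality (G □ A) a → HasCardinality (G □ B) b →
    foldr lcm 1 (map o (allFin k)) * b ℕ.≤ a
  comix-bound (_ , labelA , faithfulA) (_ , labelB , faithfulB) G∩B⊆A f reflects x x∈G x∈A o order {a} {b} cardA cardB =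
    -- Stability of the inequality allows both indices to be assumed to exist.
    decidable-stable (_ ℕₚ.≤? a) λ fail →
    index-exists {S = G.Kernel} {H = A.Kernel} A-sub (labelA ∘ A.⟦_⟧) (λ u v e → FA.Ker-\\⁺ A-hom u v (faithfulA e)) λ (r , M/A) →
    index-exists {S = G.Kernel ∩ A.Kernel} {H = B.Kernel} B-sub (labelB ∘ B.⟦_⟧) (λ u v e → FB.Ker-\\⁺ B-hom u v (faithfulB e)) λ (c , K/B) →
    fail (bound r M/A c K/B)
    where
    module GA = Comix G A
    module GB = Comix G B
    A-hom = eval-homomorphism A.group A.generator
    B-hom = eval-homomorphism B.group B.generator
    G-sub : IsSubgroup G.Kernel
    G-sub = Homomorphism.Ker-isSubgroup (Free k) G.group  (eval-homomorphism G.group G.generator)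
    A-sub : IsSubgroup A.Kernel
    A-sub = FA.Ker-isSubgroup A-hom
    B-sub : IsSubgroup B.Kernel
    B-sub = FB.Ker-isSubgroup B-hom
    K-sub : IsSubgroup (G.Kernel ∩ A.Kernel)
    K-sub = ∩-isSubgroup G-sub A-sub

    bound : ∀ r → HasIndex G.Kernel A.Kernel r → ∀ c → HasIndex (G.Kernel ∩ A.Kernel) B.Kernel c →
            foldr lcm 1 (map o (allFin k)) * b ℕ.≤ a
    bound r M/A c K/B = begin
      L * b   ≤⟨ ℕₚ.*-monoˡ-≤ b (∣⇒≤ {{c≢0}} (foldr-lcm-∣ o divides-c (allFin k))) ⟩
      c * b   ≤⟨ ℕₚ.*-cancelʳ-≤ (c * b) a r {{r≢0}} (begin
        c * b * r    ≡⟨ ℕₚ.*-comm (c * b) r ⟩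
        r * (c * b)  ≡⟨ ℕₚ.*-assoc r c b ⟨
        r * c * b    ≡⟨ ℕₚ.*-comm (r * c) b ⟩
        b * (r * c)  ≤⟨ index-≤ f A-sub _ (λ u v h → FB.Ker-\\⁺ B-hom u v (reflects u v (FA.Ker-\\⁻ A-hom (f u) (f v) h))) F/B F/A ⟩
        a * r        ∎) ⟩
      a       ∎
      where
      open ℕₚ.≤-Reasoning
      L = foldr lcm 1 (map o (allFin k))
      c≢0 = >-nonZero (index-positive K-sub K/B)
      r≢0 = >-nonZero (index-positive G-sub M/A)

      divides-c : ∀ i → o i ∣ c
      divides-c i = FB.order-∣-index {x = x i} B-hom K-sub labelB faithfulB (x∈G i , x∈A i) (order i) K/B

      -- The tower N ⊆ K ⊆ M; the lower inclusion is what `G∩B⊆A` supplies.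
      M/B : HasIndex G.Kernel B.Kernel (r * c)
      M/B = index-* G-sub A-sub B-sub (λ _ → proj₁) (λ _ → proj₂)
        (λ y y∈G y∈A → y , (y∈G , y∈A) , IsSubgroup.coset-refl B-sub y)
        G∩B⊆A M/A K/B

      -- The comix counts the cosets of the product of the kernels of `G` and `B`; that product over
      -- the kernel of `B` has the index just found, by the second isomorphism theorem.
      F/B : HasIndex U B.Kernel (b * (r * c))
      F/B = index-* U-isSubgroup GB.ComixKernel-isSubgroup B-sub _ GB.Kernel⊆ˡ
        (λ w _ → GB.ComixKernel-product w) (λ w _ → GB.Kernel⊆ʳ w) (GB.comix-index cardB) M/B

      F/A : HasIndex U A.Kernel (a * r)
      F/A = index-* U-isSubgroup GA.ComixKernel-isSubgroup A-sub _ GA.Kernel⊆ˡ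
        (λ w _ → GA.ComixKernel-product w) (λ w _ → GA.Kernel⊆ʳ w) (GA.comix-index cardA) M/A

-- Duplicate-free lists, chains and pairs

lookup-injective : ∀ {A : Set} {xs : List A} → Unique xs → ∀ {i j} → lookup xs i ≡ lookup xs j → i ≡ j
lookup-injective (_  ∷ _) {zero}  {zero}  e = ≡.refl
lookup-injective (x≢ ∷ _) {zero}  {suc j} e = contradiction e (All.lookup x≢ (∈-lookup j))
lookup-injective (x≢ ∷ _) {suc i} {zero}  e = contradiction (≡.sym e) (All.lookup x≢ (∈-lookup i))
lookup-injective (_  ∷ u) {suc i} {suc j} e = cong suc (lookup-injective u e)

unique-length : ∀ {q} {xs : List (Fin q)} → Unique xs → length xs ℕ.≤ q
unique-length u = Finₚ.injective⇒≤ (lookup-injective u)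

-- A missing element could be prepended, giving more than `q` distinct elements of `Fin q`.
unique-full : ∀ {q} {xs : List (Fin q)} → Unique xs → length xs ≡ q → ∀ i → i ∈ xs
unique-full {q} {xs} u len i = decidable-stable (i ∈? xs) λ i∉ → contradiction
  (unique-length (Allₚ.¬Any⇒All¬ xs i∉ ∷ u)) (ℕₚ.<⇒≱ (s≤s (ℕₚ.≤-reflexive (≡.sym len))))
  where open DecMembership (Finₚ._≟_ {q}) using (_∈?_)

allPairs-lookup : ∀ {A : Set} {R : Rel A 0ℓ} {xs : List A} → AllPairs R xs →
                  ∀ {x y} → x ∈ xs → y ∈ xs → x ≡ y ⊎ R x y ⊎ R y x
allPairs-lookup (_  ∷ _) (here ≡.refl) (here ≡.refl) = inj₁ ≡.refl
allPairs-lookup (rs ∷ _) (here ≡.refl) (there y∈)    = inj₂ (inj₁ (All.lookup rs y∈))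
allPairs-lookup (rs ∷ _) (there x∈)    (here ≡.refl) = inj₂ (inj₂ (All.lookup rs x∈))
allPairs-lookup (_  ∷ p) (there x∈)    (there y∈)    = allPairs-lookup p x∈ y∈

exactlyTwo-other : ∀ {A : Set} {P : Pred A 0ℓ} → ExactlyTwo P → ∀ {x y z} → P x → P y → P z →
                   x ≢ y → x ≢ z → y ≡ z
exactlyTwo-other (_ , _ , _ , _ , _ , only) px py pz x≢y x≢z with only _ px | only _ py | only _ pz
... | inj₁ ≡.refl | inj₁ ≡.refl | _           = contradiction ≡.refl x≢y
... | inj₁ ≡.refl | _           | inj₁ ≡.refl = contradiction ≡.refl x≢z
... | inj₂ ≡.refl | inj₂ ≡.refl | _           = contradiction ≡.refl x≢y
... | inj₂ ≡.refl | _           | inj₂ ≡.refl = contradiction ≡.refl x≢z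
... | _           | inj₁ ≡.refl | inj₁ ≡.refl = ≡.refl
... | _           | inj₂ ≡.refl | inj₂ ≡.refl = ≡.refl

-- Rigidity of the action on flags

module Flags {n : ℕ} (P : Polytope n) (_≟_ : DecidableEquality (Polytope.Face P)) where
  open Polytope P
  open FlagExchange P
  open Automorphisms P
  open DecMembership _≟_ using (_∈?_)

  -- Faces and flags

  comparable-rank : ∀ {F G} → F ≢ G → Comparable F G → rank F ≢ rank G
  comparable-rank F≢G (inj₁ F≤G) e = Finₚ.<-irrefl e (rank-mono (F≤G , F≢G))
  comparable-rank F≢G (inj₂ G≤F) e = Finₚ.<-irrefl (≡.sym e) (rank-mono (G≤F , F≢G ∘ ≡.sym))

  chain-ranks : ∀ {c} → Unique c → AllPairs Comparable c → Unique (map rank c)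
  chain-ranks u ch = AllPairsₚ.map⁺ (AllPairs.zipWith (λ (F≢G , cmp) → comparable-rank F≢G cmp) (u , ch))

  chain-length : ∀ {c} → Unique c → AllPairs Comparable c → length c ℕ.≤ 2 + n
  chain-length {c} u ch = subst (ℕ._≤ 2 + n) (length-map rank c) (unique-length (chain-ranks u ch))

  -- A chain of more than n + 2 faces would repeat a rank, so extending it must
  -- stop at a maximal chain, which by maximal-length then meets every rank.
  extend-chain : ∀ {F} k c → Unique c → AllPairs Comparable c → F ∈ c → 2 + n ℕ.< length c + k →
                 DoubleNegation (∃ λ d → MaximalChain d × F ∈ d)
  extend-chain zero c u ch F∈ long _ = ℕₚ.<⇒≱ long
    (ℕₚ.≤-trans (ℕₚ.≤-reflexive (ℕₚ.+-identityʳ (length c))) (chain-length u ch))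
  extend-chain (suc k) c u ch F∈ long done =
    ¬¬-excluded-middle {A = ∃ λ G → All (Comparable G) c × G ∉ c} λ
      { (yes (G , cmp , G∉)) → extend-chain k (G ∷ c) (Allₚ.¬Any⇒All¬ c G∉ ∷ u) (cmp ∷ ch) (there F∈)
          (subst (2 + n ℕ.<_) (ℕₚ.+-suc (length c) k) long) done
      ; (no none) → done (c , record
          { unique = u
          ; chain = ch
          ; maximal = λ G cmp → decidable-stable (G ∈? c) λ G∉ → none (G , cmp , G∉)
          } , F∈)
      }

  module _ {c} (mc : MaximalChain c) where
    open MaximalChain mc

    member-of-rank : ∀ r → ∃ λ G → G ∈ c × r ≡ rank G
    member-of-rank r = ∈-map⁻ rank (unique-full (chain-ranks unique chain)
      (≡.trans (length-map rank c) (maximal-length c mc)) r)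

    member : Fin (2 + n) → Face
    member r = proj₁ (member-of-rank r)

    rank-member : ∀ r → rank (member r) ≡ r
    rank-member r = ≡.sym (proj₂ (proj₂ (member-of-rank r)))

    member∈ : ∀ r → member r ∈ c
    member∈ r = proj₁ (proj₂ (member-of-rank r))

    member-rank : ∀ {F} → F ∈ c → member (rank F) ≡ F
    member-rank {F} F∈ = decidable-stable (_ ≟ F) λ ne → Sum.[ ne , Sum.[
        (λ cmp → comparable-rank ne cmp (rank-member _)) ,
        (λ cmp → comparable-rank (ne ∘ ≡.sym) cmp (≡.sym (rank-member _))) ] ]
      (allPairs-lookup chain (member∈ (rank F)) F∈)

    chainFlag : Flag n
    chainFlag = record { face = member ; ascending = λ i<j → ascends i<j (allPairs-lookup chain (member∈ _) (member∈ _)) }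
      where
      distinct : ∀ {i j} → i Fin.< j → member i ≢ member j
      distinct {i} {j} i<j e = Finₚ.<-irrefl
        (≡.trans (≡.sym (rank-member i)) (≡.trans (cong rank e) (rank-member j))) i<j

      directed : ∀ {i j} → i Fin.< j → Comparable (member i) (member j) → member i < member j
      directed i<j (inj₁ le) = le , distinct i<j
      directed {i} {j} i<j (inj₂ ge) = contradiction
        (subst₂ Fin._<_ (rank-member j) (rank-member i) (rank-mono (ge , distinct i<j ∘ ≡.sym))) (Finₚ.<-asym i<j)

      ascends : ∀ {i j} → i Fin.< j → member i ≡ member j ⊎ Comparable (member i) (member j) ⊎ Comparable (member j) (member i) →
                member i < member j
      ascends i<j (inj₁ e) = contradiction e (distinct i<j)
      ascends i<j (inj₂ (inj₁ cmp)) = directed i<j cmp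
      ascends i<j (inj₂ (inj₂ cmp)) = directed i<j (Sum.swap cmp)

  -- Connectedness speaks of flags only; this brings arbitrary faces within its reach. The double
  -- negation is harmless where faces are compared, their equality being decidable.
  face-in-flag : ∀ F → DoubleNegation (∃ λ (Ψ : Flag n) → F ∈F Ψ)
  -- One face and fuel 2 + n together exceed the possible length of a chain by one.
  face-in-flag F done = extend-chain (2 + n) (F ∷ []) ([] ∷ []) ([] ∷ []) (here ≡.refl) (ℕₚ.n<1+n _)
    λ (c , mc , F∈) → done (chainFlag mc , rank F , member-rank mc F∈)

  -- With `face-top`, this rules out adjacency at the two extreme positions, so every adjacency
  -- happens at some `position j`.
  face-zero : ∀ (Φ : Flag n) → face Φ zero ≡ least
  face-zero Φ = decidable-stable (_ ≟ _) λ ne → contradiction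
    (subst₂ Fin._<_ least-rank (rank-face Φ zero) (rank-mono (least-least _ , ne ∘ ≡.sym))) λ ()

  face-top : ∀ (Φ : Flag n) → face Φ (fromℕ (suc n)) ≡ greatest
  face-top Φ = decidable-stable (_ ≟ _) λ ne → Finₚ.<-irrefl ≡.refl
    (subst₂ Fin._<_ (rank-face Φ _) greatest-rank (rank-mono (greatest-great _ , ne)))

  -- Exchanging faces

  -- Φ ^ j behind a seal: equality of flags unfolds to equality of all faces, so
  -- unsealed exchanges would be compared through their construction.
  abstract
    infixl 8 _↑_

    _↑_ : Flag n → Fin n → Flag n
    Φ ↑ j = Φ ^ j

    ↑-adjacentAt : ∀ Φ j → AdjacentAt (position j) Φ (Φ ↑ j)
    ↑-adjacentAt = ^-adjacentAt

  toℕ-position : ∀ (j : Fin n) → toℕ (position j) ≡ suc (toℕ j)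
  toℕ-position j = cong suc (Finₚ.toℕ-inject₁ j)

  below above : Fin n → Fin (2 + n)
  below j = inject₁ (inject₁ j)
  above j = suc (suc j)

  toℕ-below : ∀ j → toℕ (below j) ≡ toℕ j
  toℕ-below j = ≡.trans (Finₚ.toℕ-inject₁ (inject₁ j)) (Finₚ.toℕ-inject₁ j)

  below<position : ∀ j → below j Fin.< position j
  below<position j = ℕₚ.≤-reflexive (≡.trans (cong suc (toℕ-below j)) (≡.sym (toℕ-position j)))

  position<above : ∀ j → position j Fin.< above j
  position<above j = ℕₚ.≤-reflexive (cong suc (toℕ-position j))

  Between : Face → Face → Face → Set
  Between F G H = toℕ (rank H) ≡ 1 + toℕ (rank F) × F < H × H < G

  between : ∀ (X : Flag n) j → Between (face X (below j)) (face X (above j)) (face X (position j))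
  between X j =
    ≡.trans (cong toℕ (rank-face X (position j))) (≡.trans (toℕ-position j)
      (cong suc (≡.trans (≡.sym (toℕ-below j)) (cong toℕ (≡.sym (rank-face X (below j))))))) ,
    ascending X (below<position j) , ascending X (position<above j)

  -- The agreement below and above puts the three middle faces into one diamond, which has room for
  -- a single face besides that of `X`.
  middle-unique : ∀ (X Y Z : Flag n) j →
    face X (below j) ≡ face Y (below j) → face X (above j) ≡ face Y (above j) →
    face X (below j) ≡ face Z (below j) → face X (above j) ≡ face Z (above j) →
    face X (position j) ≢ face Y (position j) → face X (position j) ≢ face Z (position j) →
    face Y (position j) ≡ face Z (position j)
  middle-unique X Y Z j by ay bz az = exactlyTwo-other
    (diamond (ascending X (Finₚ.<-trans (below<position j) (position<above j)))
      (≡.trans (cong toℕ (rank-face X (above j)))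
        (cong (2 +_) (≡.trans (≡.sym (toℕ-below j)) (cong toℕ (≡.sym (rank-face X (below j))))))))
    (between X j)
    (subst₂ (λ F G → Between F G (face Y (position j))) (≡.sym by) (≡.sym ay) (between Y j))
    (subst₂ (λ F G → Between F G (face Z (position j))) (≡.sym bz) (≡.sym az) (between Z j))

  flag-refl : ∀ {X : Flag n} → X ≈ X
  flag-refl i = ≡.refl

  flag-sym : ∀ {X Y : Flag n} → X ≈ Y → Y ≈ X
  flag-sym e i = ≡.sym (e i)

  flag-trans : ∀ {X Y Z : Flag n} → X ≈ Y → Y ≈ Z → X ≈ Z
  flag-trans e e′ i = ≡.trans (e i) (e′ i)

  flagSetoid : Setoid 0ℓ 0ℓ
  flagSetoid = record
    { Carrier = Flag n
    ; _≈_ = _≈_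
    ; isEquivalence = record
      { refl = λ {X} → flag-refl {X}
      ; sym = λ {X} {Y} → flag-sym {X} {Y}
      ; trans = λ {X} {Y} {Z} → flag-trans {X} {Y} {Z}
      }
    }

  adjacentAt-unique : ∀ p (X Y Z : Flag n) → AdjacentAt p X Y → AdjacentAt p X Z → Y ≈ Z
  adjacentAt-unique zero X Y Z (ne , _) _ = contradiction (≡.trans (face-zero X) (≡.sym (face-zero Y))) ne
  adjacentAt-unique (suc q) X Y Z (ne , e) (ne′ , e′) with view q
  ... | ‵fromℕ = contradiction (≡.trans (face-top X) (≡.sym (face-top Y))) ne
  ... | ‵inject₁ j = agree
    where
    below≢ : below j ≢ position j
    below≢ eq = Finₚ.<-irrefl eq (below<position j)

    above≢ : above j ≢ position j
    above≢ eq = Finₚ.<-irrefl (≡.sym eq) (position<above j)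

    agree : Y ≈ Z
    agree i with i Finₚ.≟ position j
    ... | yes ≡.refl = middle-unique X Y Z j (e _ below≢) (e _ above≢) (e′ _ below≢) (e′ _ above≢) ne ne′
    ... | no i≢      = ≡.trans (≡.sym (e i i≢)) (e′ i i≢)

  adjacentAt-sym : ∀ {p} {X Y : Flag n} → AdjacentAt p X Y → AdjacentAt p Y X
  adjacentAt-sym (ne , e) = ne ∘ ≡.sym , λ i i≢ → ≡.sym (e i i≢)

  adjacentAt-resp : ∀ {p} {X X′ Y : Flag n} → X ≈ X′ → AdjacentAt p X Y → AdjacentAt p X′ Y
  adjacentAt-resp x (ne , e) = (λ eq → ne (≡.trans (x _) eq)) , λ i i≢ → ≡.trans (≡.sym (x i)) (e i i≢)

  ↑-unique : ∀ {X Y j} → AdjacentAt (position j) X Y → Y ≈ X ↑ j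
  ↑-unique {X} {Y} {j} adj = adjacentAt-unique (position j) X Y (X ↑ j) adj (↑-adjacentAt X j)

  ↑-cong : ∀ {X Y} j → X ≈ Y → X ↑ j ≈ Y ↑ j
  ↑-cong {X} {Y} j e = ↑-unique {Y} {X ↑ j} (adjacentAt-resp {X = X} {Y} {X ↑ j} e (↑-adjacentAt X j))

  ↑-involutive : ∀ X j → X ↑ j ↑ j ≈ X
  ↑-involutive X j = flag-sym {X} {X ↑ j ↑ j} (↑-unique {X ↑ j} {X} (adjacentAt-sym {X = X} {X ↑ j} (↑-adjacentAt X j)))

  ↑-off : ∀ X j {i} → i ≢ position j → face (X ↑ j) i ≡ face X i
  ↑-off X j i≢ = ≡.sym (proj₂ (↑-adjacentAt X j) _ i≢)

  -- The exchange at `j` leaves alone the faces that determine the exchange at `i`. So X ↑ i ↑ j ↑ i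
  -- has the old face at `position i`, differs from X at `position j` alone, and must be X ↑ j.
  ↑-comm : ∀ X i j → suc (toℕ i) ℕ.< toℕ j → X ↑ i ↑ j ≈ X ↑ j ↑ i
  ↑-comm X i j far = flag-trans {X ↑ i ↑ j} {X ↑ i ↑ j ↑ i ↑ i} {X ↑ j ↑ i}
    (flag-sym {X ↑ i ↑ j ↑ i ↑ i} {X ↑ i ↑ j} (↑-involutive (X ↑ i ↑ j) i))
    (↑-cong {X ↑ i ↑ j ↑ i} {X ↑ j} i (↑-unique {X} {X ↑ i ↑ j ↑ i} adjacent))
    where
    Y = X ↑ i ↑ j

    apart : ∀ {p} → toℕ p ℕ.≤ suc (suc (toℕ i)) → p ≢ position j
    apart {p} le eq = ℕₚ.<⇒≱ (s≤s far) (subst (ℕ._≤ suc (suc (toℕ i))) (≡.trans (cong toℕ eq) (toℕ-position j)) le)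

    i≢j : position i ≢ position j
    i≢j = apart (ℕₚ.m≤n⇒m≤1+n (ℕₚ.≤-reflexive (toℕ-position i)))

    below≢ : below i ≢ position i
    below≢ eq = Finₚ.<-irrefl eq (below<position i)

    above≢ : above i ≢ position i
    above≢ eq = Finₚ.<-irrefl (≡.sym eq) (position<above i)

    Y-off : ∀ {p} → p ≢ position i → p ≢ position j → face Y p ≡ face X p
    Y-off p≢i p≢j = ≡.trans (↑-off (X ↑ i) j p≢j) (↑-off X i p≢i)

    Y-at : face Y (position i) ≡ face (X ↑ i) (position i)
    Y-at = ↑-off (X ↑ i) j i≢j

    back : face (Y ↑ i) (position i) ≡ face X (position i)
    back = middle-unique Y (Y ↑ i) X i
      (≡.sym (↑-off Y i below≢)) (≡.sym (↑-off Y i above≢))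
      (Y-off below≢ (apart (ℕₚ.≤-trans (ℕₚ.≤-reflexive (toℕ-below i)) (ℕₚ.m≤n+m _ 2))))
      (Y-off above≢ (apart ℕₚ.≤-refl))
      (proj₁ (↑-adjacentAt Y i))
      (λ e → proj₁ (↑-adjacentAt X i) (≡.trans (≡.sym e) Y-at))

    adjacent : AdjacentAt (position j) X (Y ↑ i)
    adjacent = (λ e → proj₁ (↑-adjacentAt (X ↑ i) j) (≡.trans (↑-off X i (i≢j ∘ ≡.sym))
        (≡.trans e (↑-off Y i (i≢j ∘ ≡.sym))))) , same
      where
      same : ∀ p → p ≢ position j → face X p ≡ face (Y ↑ i) p
      same p p≢j with p Finₚ.≟ position i
      ... | yes ≡.refl = ≡.sym back
      ... | no p≢i     = ≡.sym (≡.trans (↑-off Y i p≢i) (Y-off p≢i p≢j))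

  -- Automorphisms

  act-adjacentAt : ∀ α {p} (X Y : Flag n) → AdjacentAt p X Y → AdjacentAt p (act α X) (act α Y)
  act-adjacentAt α X Y (ne , e) = ne ∘ injective α , λ i i≢ → cong (to α) (e i i≢)

  act-cong : ∀ α {X Y : Flag n} → X ≈ Y → act α X ≈ act α Y
  act-cong α e i = cong (to α) (e i)

  act-↑ : ∀ α X j → act α (X ↑ j) ≈ act α X ↑ j
  act-↑ α X j = ↑-unique {act α X} {act α (X ↑ j)} (act-adjacentAt α X (X ↑ j) (↑-adjacentAt X j))

  -- Automorphisms preserve the position of an adjacency, and the neighbour at a given position is
  -- unique; agreement therefore travels along paths.
  act-path : ∀ α β {T : Rel (Flag n) 0ℓ} → (∀ {X Y} → T X Y → Adjacent X Y) →
             ∀ {X Y} → Star T X Y → act α X ≈ act β X → act α Y ≈ act β Y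
  act-path α β adj Star.ε e = e
  act-path α β adj {X} {Y} (Star._◅_ {j = Z} t path) e with adj t
  ... | p , at = act-path α β adj path (adjacentAt-unique p (act α X) (act α Z) (act β Z)
    (act-adjacentAt α X Z at) (adjacentAt-resp {X = act β X} {act α X} {act β Z} (flag-sym {act α X} {act β X} e) (act-adjacentAt β X Z at)))

  -- A path leads from Φ to a flag through the given face, and agreement is carried along it.
  rigid : ∀ α β (Φ : Flag n) → act α Φ ≈ act β Φ → ∀ F → to α F ≡ to β F
  rigid α β Φ e F = decidable-stable (_ ≟ _) λ ne → face-in-flag F λ (Ψ , i , at) →
    let Ω , path , Ω≈Ψ = strongly-connected Φ Ψ
        F≡ = ≡.trans (Ω≈Ψ i) at
    in ne (≡.trans (cong (to α) (≡.sym F≡)) (≡.trans (act-path α β proj₁ path e i) (cong (to β) F≡)))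

-- Automorphisms as sequences of exchanges

module Motion {n : ℕ} (P : Polytope n) (_≟_ : DecidableEquality (Polytope.Face P)) where
  open Polytope P
  open FlagExchange P
  open Automorphisms P
  open Flags P _≟_
  open import Relation.Binary.Reasoning.Setoid flagSetoid
  private module Γ = Group Γ

  infixl 8 _↑*_

  _↑*_ : Flag n → List (Fin n) → Flag n
  X ↑* []      = X
  X ↑* (i ∷ u) = X ↑ i ↑* u

  ↑*-cong : ∀ u {X Y} → X ≈ Y → X ↑* u ≈ Y ↑* u
  ↑*-cong []      e = e
  ↑*-cong (i ∷ u) {X} {Y} e = ↑*-cong u {X ↑ i} {Y ↑ i} (↑-cong {X} {Y} i e)

  ↑*-++ : ∀ X u v → X ↑* (u ++ v) ≡ X ↑* u ↑* v
  ↑*-++ X []      v = ≡.refl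
  ↑*-++ X (i ∷ u) v = ↑*-++ (X ↑ i) u v

  ↑*-reverse : ∀ X u → X ↑* u ↑* reverse u ≈ X
  ↑*-reverse X []      = flag-refl {X}
  ↑*-reverse X (i ∷ u) = begin
    X ↑ i ↑* u ↑* reverse (i ∷ u)      ≡⟨ cong (X ↑ i ↑* u ↑*_) (unfold-reverse i u) ⟩
    X ↑ i ↑* u ↑* (reverse u ++ [ i ])  ≡⟨ ↑*-++ (X ↑ i ↑* u) (reverse u) [ i ] ⟩
    X ↑ i ↑* u ↑* reverse u ↑ i        ≈⟨ ↑-cong {X ↑ i ↑* u ↑* reverse u} {X ↑ i} i (↑*-reverse (X ↑ i) u) ⟩
    X ↑ i ↑ i                          ≈⟨ ↑-involutive X i ⟩
    X                                  ∎

  act-↑* : ∀ α u X → act α (X ↑* u) ≈ act α X ↑* u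
  act-↑* α []      X = flag-refl {act α X}
  act-↑* α (i ∷ u) X = begin
    act α (X ↑ i ↑* u)    ≈⟨ act-↑* α u (X ↑ i) ⟩
    act α (X ↑ i) ↑* u    ≈⟨ ↑*-cong u {act α (X ↑ i)} {act α X ↑ i} (act-↑ α X i) ⟩
    act α X ↑ i ↑* u      ∎

  module _ (Φ : Flag n) where

    -- By rigidity the sequence determines the automorphism, so group identities become rewriting of
    -- exchange sequences by `↑-involutive` and `↑-comm`.
    Moves : Automorphism → List (Fin n) → Set
    Moves α u = act α Φ ≈ Φ ↑* u

    moves-unique : ∀ {α β} u v → Moves α u → Moves β v → Φ ↑* u ≈ Φ ↑* v → α Γ.≈ β
    moves-unique {α} {β} u v a b e = rigid α β Φ (begin
      act α Φ  ≈⟨ a ⟩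
      Φ ↑* u   ≈⟨ e ⟩
      Φ ↑* v   ≈⟨ b ⟨
      act β Φ  ∎)

    -- Stated through adjacency so that flags built with `^` can enter the calculus of the sealed
    -- `↑`.
    moves-adjacent : ∀ α {i j Ψ Ω} → AdjacentAt (position i) Φ Ψ → AdjacentAt (position j) Ψ Ω →
                     act α Φ ≈ Ω → Moves α (i ∷ j ∷ [])
    moves-adjacent α {i} {j} {Ψ} {Ω} adj adj′ e = begin
      act α Φ    ≈⟨ e ⟩
      Ω          ≈⟨ ↑-unique {Ψ} {Ω} adj′ ⟩
      Ψ ↑ j      ≈⟨ ↑-cong {Ψ} {Φ ↑ i} j (↑-unique {Φ} {Ψ} adj) ⟩
      Φ ↑ i ↑ j  ∎

    moves-id : Moves identity []
    moves-id = flag-refl {Φ}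

    -- The later factor comes first: automorphisms commute with exchanges, so
    -- the path of the first factor is transported to start at Φβ.
    moves-then : ∀ α β u v → Moves α u → Moves β v → Moves (α then β) (v ++ u)
    moves-then α β u v a b = begin
      act β (act α Φ)  ≈⟨ act-cong β {act α Φ} {Φ ↑* u} a ⟩
      act β (Φ ↑* u)   ≈⟨ act-↑* β u Φ ⟩
      act β Φ ↑* u     ≈⟨ ↑*-cong u {act β Φ} {Φ ↑* v} b ⟩
      Φ ↑* v ↑* u      ≡⟨ ↑*-++ Φ v u ⟨
      Φ ↑* (v ++ u)    ∎

    moves-inverse : ∀ α u → Moves α u → Moves (inverse α) (reverse u)
    moves-inverse α u a = begin
      act (inverse α) Φ                                ≈⟨ ↑*-reverse (act (inverse α) Φ) u ⟨
      act (inverse α) Φ ↑* u ↑* reverse u              ≈⟨ ↑*-cong (reverse u) (act-↑* (inverse α) u Φ) ⟨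
      act (inverse α) (Φ ↑* u) ↑* reverse u            ≈⟨ ↑*-cong (reverse u) (act-cong (inverse α) {act α Φ} {Φ ↑* u} a) ⟨
      act (inverse α) (act α Φ) ↑* reverse u           ≈⟨ ↑*-cong (reverse u) {act (inverse α) (act α Φ)} {Φ} (λ i → from-to α (face Φ i)) ⟩
      Φ ↑* reverse u                                   ∎

  moves-resp : ∀ {Φ Ψ} α u → Φ ≈ Ψ → Moves Φ α u → Moves Ψ α u
  moves-resp {Φ} {Ψ} α u e a = begin
    act α Ψ  ≈⟨ act-cong α {Φ} {Ψ} e ⟨
    act α Φ  ≈⟨ a ⟩
    Φ ↑* u   ≈⟨ ↑*-cong u {Φ} {Ψ} e ⟩
    Ψ ↑* u   ∎

module Rotations {m : ℕ} (P : Polytope (suc m)) (_≟_ : DecidableEquality (Polytope.Face P))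
  (Φ : Polytope.Flag P (suc m)) (σ : Fin m → Automorphisms.Automorphism P)
  (σ-moves : ∀ i → Motion.Moves P _≟_ Φ (σ i) (suc i ∷ inject₁ i ∷ []))
  where
  open Polytope P
  open Automorphisms P
  open Flags P _≟_
  open Motion P _≟_
  open import Relation.Binary.Reasoning.Setoid flagSetoid
  private module Γ = Group Γ

  -- Relations of W⁺

  product : List (Fin m) → Word (Fin m)
  product = foldr (λ l w → gen l ∙ w) ε

  module _ (i j : Fin m) where
    private
      InSegment? : (l : Fin m) → Dec (i Fin.≤ l × l Fin.≤ j)
      InSegment? l = i Finₚ.≤? l ×-dec l Finₚ.≤? j

      -- `segment` filters `allFin`; the induction needs its tails, tabulated by functions `f` with
      -- values r, r + 1, and so on.
      part : ∀ {k} → (Fin k → Fin m) → List (Fin m)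
      part f = filter InSegment? (tabulate f)

      ⟦_⟧ : List (Fin m) → Automorphism
      ⟦ ls ⟧ = eval Γ σ (product ls)

      past : ∀ {k} (f : Fin k → Fin m) → (∀ x → j Fin.< f x) → part f ≡ []
      past f late = filter-none InSegment? (Allₚ.tabulate⁺ λ x (_ , le) → ℕₚ.<⇒≱ (late x) le)

      -- Telescoping: in a composite the path of the remaining factors comes first, and its last
      -- exchange, at `suc a`, cancels the first exchange of `σ a`.
      inside : ∀ {k} (f : Fin k → Fin m) r → (∀ x → toℕ (f x) ≡ r + toℕ x) → r + k ≡ m →
               ∀ a → toℕ a ≡ r → i Fin.≤ a → a Fin.≤ j → Moves Φ ⟦ part f ⟧ (suc j ∷ inject₁ a ∷ [])
      inside {zero} f r pos end a a≡r i≤a a≤j = contradiction (Finₚ.toℕ<n a)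
        (ℕₚ.<-irrefl (≡.trans a≡r (≡.trans (≡.sym (ℕₚ.+-identityʳ r)) end)))
      inside {suc k} f r pos end a a≡r i≤a a≤j = subst (λ ls → Moves Φ ⟦ ls ⟧ (suc j ∷ inject₁ a ∷ []))
          (≡.trans (cong (_∷ part (f ∘ suc)) (≡.sym f0≡a)) (≡.sym (filter-accept InSegment? accept)))
          (continue (a Finₚ.≟ j))
        where
        f0≡a : f zero ≡ a
        f0≡a = Finₚ.toℕ-injective (≡.trans (pos zero) (≡.trans (ℕₚ.+-identityʳ r) (≡.sym a≡r)))

        accept : i Fin.≤ f zero × f zero Fin.≤ j
        accept = subst (λ l → i Fin.≤ l × l Fin.≤ j) (≡.sym f0≡a) (i≤a , a≤j)

        pos′ : ∀ x → toℕ (f (suc x)) ≡ suc r + toℕ x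
        pos′ x = ≡.trans (pos (suc x)) (ℕₚ.+-suc r (toℕ x))

        continue : Dec (a ≡ j) → Moves Φ ⟦ a ∷ part (f ∘ suc) ⟧ (suc j ∷ inject₁ a ∷ [])
        continue (yes ≡.refl) = subst (λ ls → Moves Φ ⟦ a ∷ ls ⟧ (suc j ∷ inject₁ a ∷ []))
          (≡.sym (past (f ∘ suc) λ x → subst₂ ℕ._<_ (≡.sym a≡r) (≡.sym (pos′ x)) (s≤s (ℕₚ.m≤m+n r (toℕ x)))))
          (moves-then Φ (σ a) identity (suc a ∷ inject₁ a ∷ []) [] (σ-moves a) (moves-id Φ))
        continue (no a≢j) = begin
          act (σ a then ⟦ part (f ∘ suc) ⟧) Φ
            ≈⟨ moves-then Φ (σ a) ⟦ part (f ∘ suc) ⟧ (suc a ∷ inject₁ a ∷ []) (suc j ∷ inject₁ a′ ∷ []) (σ-moves a)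
                 (inside (f ∘ suc) (suc r) pos′ (≡.trans (≡.sym (ℕₚ.+-suc r k)) end) a′ a′≡ i≤a′ a′≤j) ⟩
          Φ ↑ suc j ↑ inject₁ a′ ↑ suc a ↑ inject₁ a
            ≡⟨ cong (λ b → Φ ↑ suc j ↑ b ↑ suc a ↑ inject₁ a) (Finₚ.toℕ-injective
                 (≡.trans (Finₚ.toℕ-inject₁ a′) (≡.trans a′≡ (cong suc (≡.sym a≡r))))) ⟩
          Φ ↑ suc j ↑ suc a ↑ suc a ↑ inject₁ a
            ≈⟨ ↑-cong {Φ ↑ suc j ↑ suc a ↑ suc a} {Φ ↑ suc j} (inject₁ a) (↑-involutive (Φ ↑ suc j) (suc a)) ⟩
          Φ ↑ suc j ↑ inject₁ a ∎
          where
          a<j : a Fin.< j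
          a<j = Finₚ.≤∧≢⇒< a≤j a≢j

          in-range : suc r ℕ.< m
          in-range = ℕₚ.≤-<-trans (subst (λ r → suc r ℕ.≤ toℕ j) a≡r a<j) (Finₚ.toℕ<n j)

          a′ : Fin m
          a′ = fromℕ< in-range

          a′≡ : toℕ a′ ≡ suc r
          a′≡ = Finₚ.toℕ-fromℕ< in-range

          i≤a′ : i Fin.≤ a′
          i≤a′ = ℕₚ.≤-trans i≤a (ℕₚ.≤-trans (ℕₚ.n≤1+n _) (ℕₚ.≤-reflexive (≡.trans (cong suc a≡r) (≡.sym a′≡))))

          a′≤j : a′ Fin.≤ j
          a′≤j = ℕₚ.≤-trans (ℕₚ.≤-reflexive (≡.trans a′≡ (cong suc (≡.sym a≡r)))) a<j

      before : ∀ {k} (f : Fin k → Fin m) r → (∀ x → toℕ (f x) ≡ r + toℕ x) → r + k ≡ m →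
               i Fin.≤ j → r ℕ.≤ toℕ i → Moves Φ ⟦ part f ⟧ (suc j ∷ inject₁ i ∷ [])
      before {k} f r pos end i≤j r≤i with toℕ i ℕₚ.≟ r
      ... | yes i≡r = inside f r pos end i i≡r ℕₚ.≤-refl i≤j
      before {zero} f r pos end i≤j r≤i | no i≢r = contradiction r≤i
        (ℕₚ.<⇒≱ (ℕₚ.<-≤-trans (Finₚ.toℕ<n i) (ℕₚ.≤-reflexive (≡.trans (≡.sym end) (ℕₚ.+-identityʳ r)))))
      before {suc k} f r pos end i≤j r≤i | no i≢r = subst (λ ls → Moves Φ ⟦ ls ⟧ (suc j ∷ inject₁ i ∷ []))
        (≡.sym (filter-reject InSegment? reject))
        (before (f ∘ suc) (suc r) (λ x → ≡.trans (pos (suc x)) (ℕₚ.+-suc r (toℕ x)))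
          (≡.trans (≡.sym (ℕₚ.+-suc r k)) end) i≤j r<i)
        where
        r<i : r ℕ.< toℕ i
        r<i = ℕₚ.≤∧≢⇒< r≤i (i≢r ∘ ≡.sym)

        reject : ¬ (i Fin.≤ f zero × f zero Fin.≤ j)
        reject (i≤ , _) = ℕₚ.<⇒≱ r<i (ℕₚ.≤-trans i≤ (ℕₚ.≤-reflexive (≡.trans (pos zero) (ℕₚ.+-identityʳ r))))

    segment-moves : i Fin.≤ j → Moves Φ (eval Γ σ (segment i j)) (suc j ∷ inject₁ i ∷ [])
    segment-moves i≤j = before id 0 (λ _ → ≡.refl) ≡.refl i≤j z≤n

  -- For i < j the segment amounts to two exchanges at ranks at least 2 apart. They are commuting
  -- involutions, so doing both twice returns to Φ.
  relator-trivial : ∀ {w} → W⁺-Relator w → eval Γ σ w Γ.≈ Γ.ε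
  relator-trivial (square {i} {j} i<j) = moves-unique Φ {τ then τ} {identity} (b ∷ a ∷ b ∷ a ∷ []) []
    (moves-then Φ τ τ (b ∷ a ∷ []) (b ∷ a ∷ []) τ-moves τ-moves) (moves-id Φ) (begin
      Φ ↑ b ↑ a ↑ b ↑ a  ≈⟨ ↑-cong {Φ ↑ b ↑ a ↑ b} {Φ ↑ b ↑ b ↑ a} a (↑-comm (Φ ↑ b) a b far) ⟩
      Φ ↑ b ↑ b ↑ a ↑ a  ≈⟨ ↑-involutive (Φ ↑ b ↑ b) a ⟩
      Φ ↑ b ↑ b          ≈⟨ ↑-involutive Φ b ⟩
      Φ                  ∎)
    where
    a = inject₁ i
    b = suc j
    τ = eval Γ σ (segment i j)
    τ-moves = segment-moves i j (ℕₚ.<⇒≤ i<j)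
    far : suc (toℕ a) ℕ.< toℕ b
    far = s≤s (subst (ℕ._< toℕ j) (≡.sym (Finₚ.toℕ-inject₁ i)) i<j)

-- Generators of the mirror image

module Mirror {m : ℕ} (P : Polytope (suc m)) (_≟_ : DecidableEquality (Polytope.Face P))
  (Φ : Polytope.Flag P (suc m)) (σ σ̄ : Fin m → Automorphisms.Automorphism P)
  (σ-moves : ∀ i → Motion.Moves P _≟_ Φ (σ i) (suc i ∷ inject₁ i ∷ []))
  (σ̄-moves₀ : ∀ i → Motion.Moves P _≟_ (Flags._↑_ P _≟_ Φ zero) (σ̄ i) (suc i ∷ inject₁ i ∷ []))
  where
  open Polytope P
  open Automorphisms P
  open Flags P _≟_
  open Motion P _≟_
  open import Relation.Binary.Reasoning.Setoid flagSetoid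
  private module Γ = Group Γ

  -- `σ̄ i` is known on `Φ ↑ zero`. Since automorphisms commute with exchanges, enclosing its path
  -- between two exchanges at `zero` describes it on Φ, where it can be compared with `σ`.
  σ̄-moves : ∀ i → Moves Φ (σ̄ i) (zero ∷ suc i ∷ inject₁ i ∷ zero ∷ [])
  σ̄-moves i = begin
    act (σ̄ i) Φ                              ≈⟨ ↑-involutive (act (σ̄ i) Φ) zero ⟨
    act (σ̄ i) Φ ↑ zero ↑ zero                ≈⟨ ↑-cong {act (σ̄ i) (Φ ↑ zero)} {act (σ̄ i) Φ ↑ zero} zero (act-↑ (σ̄ i) Φ zero) ⟨
    act (σ̄ i) (Φ ↑ zero) ↑ zero              ≈⟨ ↑-cong {act (σ̄ i) (Φ ↑ zero)} {Φ ↑ zero ↑ suc i ↑ inject₁ i} zero (σ̄-moves₀ i) ⟩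
    Φ ↑ zero ↑ suc i ↑ inject₁ i ↑ zero      ∎

  -- For arbitrary `m` the type `Fin m` has no literal first element; the equation singles it out,
  -- as `inject₁ j ≡ suc i` later does for the second.
  σ̄-zero-moves : ∀ i → inject₁ i ≡ zero → Moves Φ (σ̄ i) (zero ∷ suc i ∷ [])
  σ̄-zero-moves i e = begin
    act (σ̄ i) Φ                          ≈⟨ σ̄-moves i ⟩
    Φ ↑ zero ↑ suc i ↑ inject₁ i ↑ zero  ≡⟨ cong (λ a → Φ ↑ zero ↑ suc i ↑ a ↑ zero) e ⟩
    Φ ↑ zero ↑ suc i ↑ zero ↑ zero       ≈⟨ ↑-involutive (Φ ↑ zero ↑ suc i) zero ⟩
    Φ ↑ zero ↑ suc i                     ∎

  mirror-later : ∀ i → 1 ℕ.< toℕ i → σ̄ i Γ.≈ σ i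
  mirror-later i 1<i = moves-unique Φ {σ̄ i} {σ i} (zero ∷ b ∷ a ∷ zero ∷ []) (b ∷ a ∷ [])
    (σ̄-moves i) (σ-moves i) (begin
      Φ ↑ zero ↑ b ↑ a ↑ zero  ≈⟨ ↑-cong {Φ ↑ zero ↑ b ↑ a} {Φ ↑ b ↑ zero ↑ a} zero
                                    (↑-cong {Φ ↑ zero ↑ b} {Φ ↑ b ↑ zero} a (↑-comm Φ zero b (ℕₚ.m≤n⇒m≤1+n 1<i))) ⟩
      Φ ↑ b ↑ zero ↑ a ↑ zero  ≈⟨ ↑-cong {Φ ↑ b ↑ zero ↑ a} {Φ ↑ b ↑ a ↑ zero} zero
                                    (↑-comm (Φ ↑ b) zero a (subst (1 ℕ.<_) (≡.sym (Finₚ.toℕ-inject₁ i)) 1<i)) ⟩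
      Φ ↑ b ↑ a ↑ zero ↑ zero  ≈⟨ ↑-involutive (Φ ↑ b ↑ a) zero ⟩
      Φ ↑ b ↑ a                ∎)
    where
    a b : Fin (suc m)
    a = inject₁ i
    b = suc i

  mirror-first : ∀ i → inject₁ i ≡ zero → σ̄ i Γ.≈ σ i Γ.⁻¹
  mirror-first i e = moves-unique Φ {σ̄ i} {inverse (σ i)} (zero ∷ suc i ∷ []) (inject₁ i ∷ suc i ∷ [])
    (σ̄-zero-moves i e) (moves-inverse Φ (σ i) (suc i ∷ inject₁ i ∷ []) (σ-moves i))
    λ p → cong (λ a → face (Φ ↑ a ↑ suc i) p) (≡.sym e)

  module _ (i j : Fin m) (first : inject₁ i ≡ zero) (second : inject₁ j ≡ suc i) where
    private
      0′ 1′ 2′ : Fin (suc m)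
      0′ = zero
      1′ = suc i
      2′ = suc j

      σᵢ : Moves Φ (σ i) (1′ ∷ 0′ ∷ [])
      σᵢ = subst (λ a → Moves Φ (σ i) (1′ ∷ a ∷ [])) first (σ-moves i)

      σⱼ : Moves Φ (σ j) (2′ ∷ 1′ ∷ [])
      σⱼ = subst (λ a → Moves Φ (σ j) (2′ ∷ a ∷ [])) second (σ-moves j)

      σ̄ⱼ : Moves Φ (σ̄ j) (0′ ∷ 2′ ∷ 1′ ∷ 0′ ∷ [])
      σ̄ⱼ = subst (λ a → Moves Φ (σ̄ j) (0′ ∷ 2′ ∷ a ∷ 0′ ∷ [])) second (σ̄-moves j)

      0-2-far : 1 ℕ.< toℕ 2′
      0-2-far = s≤s (subst (0 ℕ.<_) (≡.trans (cong toℕ (≡.sym second)) (Finₚ.toℕ-inject₁ j)) (s≤s z≤n))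

    -- Exhibits the second mirror generator as a conjugate of an inverse, the form through which
    -- `times-mirror` transfers powers.
    mirror-second : σ̄ j Γ.≈ σ i Γ.∙ σ j Γ.⁻¹ Γ.∙ σ i Γ.⁻¹
    mirror-second = moves-unique Φ {σ̄ j} {σ i then inverse (σ j) then inverse (σ i)}
      (0′ ∷ 2′ ∷ 1′ ∷ 0′ ∷ []) (0′ ∷ 1′ ∷ 1′ ∷ 2′ ∷ 1′ ∷ 0′ ∷ []) σ̄ⱼ
      (moves-then Φ (σ i then inverse (σ j)) (inverse (σ i)) (1′ ∷ 2′ ∷ 1′ ∷ 0′ ∷ []) (0′ ∷ 1′ ∷ [])
        (moves-then Φ (σ i) (inverse (σ j)) (1′ ∷ 0′ ∷ []) (1′ ∷ 2′ ∷ []) σᵢ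
          (moves-inverse Φ (σ j) (2′ ∷ 1′ ∷ []) σⱼ))
        (moves-inverse Φ (σ i) (1′ ∷ 0′ ∷ []) σᵢ))
      (flag-sym {Φ ↑ 0′ ↑ 1′ ↑ 1′ ↑ 2′ ↑ 1′ ↑ 0′} {Φ ↑ 0′ ↑ 2′ ↑ 1′ ↑ 0′}
        (↑*-cong (2′ ∷ 1′ ∷ 0′ ∷ []) {Φ ↑ 0′ ↑ 1′ ↑ 1′} {Φ ↑ 0′} (↑-involutive (Φ ↑ 0′) 1′)))

    -- The left side is the value, in the mirror generators, of `bar` on the second generator.
    mirror-product : σ̄ i Γ.∙ σ̄ i Γ.∙ σ̄ j Γ.≈ σ j
    mirror-product = moves-unique Φ {σ̄ i then σ̄ i then σ̄ j} {σ j}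
      (0′ ∷ 2′ ∷ 1′ ∷ 0′ ∷ 0′ ∷ 1′ ∷ 0′ ∷ 1′ ∷ []) (2′ ∷ 1′ ∷ [])
      (moves-then Φ (σ̄ i then σ̄ i) (σ̄ j) (0′ ∷ 1′ ∷ 0′ ∷ 1′ ∷ []) (0′ ∷ 2′ ∷ 1′ ∷ 0′ ∷ [])
        (moves-then Φ (σ̄ i) (σ̄ i) (0′ ∷ 1′ ∷ []) (0′ ∷ 1′ ∷ []) (σ̄-zero-moves i first) (σ̄-zero-moves i first))
        σ̄ⱼ)
      σⱼ
      (begin
        Φ ↑ 0′ ↑ 2′ ↑ 1′ ↑ 0′ ↑ 0′ ↑ 1′ ↑ 0′ ↑ 1′
          ≈⟨ ↑*-cong (1′ ∷ 0′ ∷ 1′ ∷ []) {Φ ↑ 0′ ↑ 2′ ↑ 1′ ↑ 0′ ↑ 0′} {Φ ↑ 0′ ↑ 2′ ↑ 1′} (↑-involutive (Φ ↑ 0′ ↑ 2′ ↑ 1′) 0′) ⟩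
        Φ ↑ 0′ ↑ 2′ ↑ 1′ ↑ 1′ ↑ 0′ ↑ 1′
          ≈⟨ ↑*-cong (0′ ∷ 1′ ∷ []) {Φ ↑ 0′ ↑ 2′ ↑ 1′ ↑ 1′} {Φ ↑ 0′ ↑ 2′} (↑-involutive (Φ ↑ 0′ ↑ 2′) 1′) ⟩
        Φ ↑ 0′ ↑ 2′ ↑ 0′ ↑ 1′
          ≈⟨ ↑*-cong (0′ ∷ 1′ ∷ []) {Φ ↑ 0′ ↑ 2′} {Φ ↑ 2′ ↑ 0′} (↑-comm Φ 0′ 2′ 0-2-far) ⟩
        Φ ↑ 2′ ↑ 0′ ↑ 0′ ↑ 1′
          ≈⟨ ↑-cong {Φ ↑ 2′ ↑ 0′ ↑ 0′} {Φ ↑ 2′} 1′ (↑-involutive (Φ ↑ 2′) 0′) ⟩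
        Φ ↑ 2′ ↑ 1′ ∎)

module _ {m : ℕ} (P : Polytope (suc m)) (_≟_ : DecidableEquality (Polytope.Face P))
  (Φ : Polytope.Flag P (suc m)) (σ σ̄ : Fin m → Automorphisms.Automorphism P)
  (σ-moves : ∀ i → Motion.Moves P _≟_ Φ (σ i) (suc i ∷ inject₁ i ∷ []))
  (σ̄-moves₀ : ∀ i → Motion.Moves P _≟_ (Flags._↑_ P _≟_ Φ zero) (σ̄ i) (suc i ∷ inject₁ i ∷ []))
  where
  open Automorphisms P
  private module Γ = Group Γ
  open Mirror P _≟_ Φ σ σ̄ σ-moves σ̄-moves₀

  eval-bar-gen : ∀ i → eval Γ σ̄ (bar (gen i)) Γ.≈ σ i
  eval-bar-gen zero          = Γ.trans {inverse (σ̄ zero)} {inverse (inverse (σ zero))} {σ zero}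
    (Γ.⁻¹-cong {σ̄ zero} {inverse (σ zero)} (mirror-first zero ≡.refl)) (GroupProperties.⁻¹-involutive Γ (σ zero))
  eval-bar-gen (suc zero)    = mirror-product zero (suc zero) ≡.refl ≡.refl
  eval-bar-gen (suc (suc i)) = mirror-later (suc (suc i)) (s≤s (s≤s z≤n))

  -- Both families of generators lie in the same group Γ, and `bar` is the change of generators
  -- between them.
  eval-bar : ∀ w → eval Γ σ̄ (bar w) Γ.≈ eval Γ σ w
  eval-bar (gen i) = eval-bar-gen i
  eval-bar ε       = Γ.refl {identity}
  eval-bar (u ∙ v) = Γ.∙-cong {eval Γ σ̄ (bar u)} {eval Γ σ u} {eval Γ σ̄ (bar v)} {eval Γ σ v} (eval-bar u) (eval-bar v)
  eval-bar (u ⁻¹)  = Γ.⁻¹-cong {eval Γ σ̄ (bar u)} {eval Γ σ u} (eval-bar u)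

  open Orders Γ

  -- `σ̄ i` is the inverse of `σ i`, a conjugate of that inverse, or `σ i` itself. Hence the power
  -- of σᵢ by its order lies in M̄ as well as in M.
  times-mirror : ∀ i n → n times σ i Γ.≈ Γ.ε → n times σ̄ i Γ.≈ Γ.ε
  times-mirror zero n e = Γ.trans {n times σ̄ zero} {n times inverse (σ zero)} {identity}
    (×-congʳ n {σ̄ zero} {inverse (σ zero)} (mirror-first zero ≡.refl)) (times-⁻¹ (σ zero) n e)
  times-mirror (suc zero) n e = Γ.trans {n times σ̄ (suc zero)} {n times τ} {identity}
    (×-congʳ n {σ̄ (suc zero)} {τ} (mirror-second zero (suc zero) ≡.refl ≡.refl))
    (times-conjugate (σ zero) (inverse (σ (suc zero))) n (times-⁻¹ (σ (suc zero)) n e))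
    where τ = σ zero then inverse (σ (suc zero)) then inverse (σ zero)
  times-mirror (suc (suc i)) n e = Γ.trans {n times σ̄ (suc (suc i))} {n times σ (suc (suc i))} {identity}
    (×-congʳ n {σ̄ (suc (suc i))} {σ (suc (suc i))} (mirror-later (suc (suc i)) (s≤s (s≤s z≤n)))) e

-- Generators of the dual

opposite-inject₁ : ∀ {n} (i : Fin n) → opposite (inject₁ i) ≡ suc (opposite i)
opposite-inject₁ zero    = ≡.refl
opposite-inject₁ (suc i) = cong inject₁ (opposite-inject₁ i)

opposite-position : ∀ {n} (j : Fin n) → opposite (position j) ≡ position (opposite j)
opposite-position j = cong inject₁ (opposite-inject₁ j)

delta : ∀ {k} → Word (Fin k) → Word (Fin k)
delta w = w >>= λ i → gen (opposite i) ⁻¹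

module Dual {m : ℕ} (P : Polytope (suc m)) (_≟_ : DecidableEquality (Polytope.Face P))
  (Φ : Polytope.Flag P (suc m)) (σ : Fin m → Automorphisms.Automorphism P)
  (σ-moves : ∀ i → Motion.Moves P _≟_ Φ (σ i) (suc i ∷ inject₁ i ∷ []))
  (τ : Fin m → Automorphisms.Automorphism (dual P))
  (τ-moves : ∀ i → Motion.Moves (dual P) _≟_ (reverseFlag P Φ) (τ i) (suc i ∷ inject₁ i ∷ []))
  where
  open Polytope P
  open Automorphisms P
  open Flags P _≟_
  open Motion P _≟_
  private
    module D = Polytope (dual P)
    module AD = Automorphisms (dual P)
    module FD = Flags (dual P) _≟_
    module Γ = Group Γ
    module Γᵟ = Group AD.Γ

  fromDual : AD.Automorphism → Automorphism
  fromDual α = record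
    { to = AD.to α
    ; isOrderIsomorphism = record
      { isOrderMonomorphism = record
        { isOrderHomomorphism = record { cong = cong (AD.to α) ; mono = AD.mono α }
        ; injective = AD.injective α
        ; cancel = AD.cancel α
        }
      ; surjective = AD.surjective α
      }
    }

  reverse-↑ : ∀ X j → reverseFlag P X FD.↑ j D.≈ reverseFlag P (X ↑ opposite j)
  reverse-↑ X j = FD.flag-sym {reverseFlag P (X ↑ opposite j)} {reverseFlag P X FD.↑ j}
    (FD.↑-unique {reverseFlag P X} {reverseFlag P (X ↑ opposite j)}
      ( (λ e → proj₁ (↑-adjacentAt X (opposite j)) (subst (λ p → face X p ≡ face (X ↑ opposite j) p) (opposite-position j) e))
      , (λ i i≢ → proj₂ (↑-adjacentAt X (opposite j)) (opposite i) λ e → i≢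
          (≡.trans (≡.sym (Finₚ.opposite-involutive i)) (≡.trans (cong opposite (≡.trans e (≡.sym (opposite-position j))))
            (Finₚ.opposite-involutive (position j)))))))

  -- `opposite` turns `suc i` into `inject₁ (opposite i)` and `inject₁ i` into `suc (opposite i)`.
  -- The two exchanges of `σ (opposite i)` thus appear in reverse order, which is the path of its
  -- inverse.
  fromDual-moves : ∀ i → Moves Φ (fromDual (τ i)) (inject₁ (opposite i) ∷ suc (opposite i) ∷ [])
  fromDual-moves i p = ≡.trans (cong (AD.to (τ i) ∘ face Φ) (≡.sym (Finₚ.opposite-involutive p)))
    (≡.trans (steps (opposite p)) (cong (face Ψ) (Finₚ.opposite-involutive p)))
    where
    Ψ = Φ ↑ inject₁ (opposite i) ↑ suc (opposite i)
    Φᵟ = reverseFlag P Φ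
    steps : AD.act (τ i) Φᵟ D.≈ reverseFlag P Ψ
    steps q = ≡.trans (τ-moves i q) (≡.trans
      (FD.↑-cong {Φᵟ FD.↑ suc i} {reverseFlag P (Φ ↑ inject₁ (opposite i))} (inject₁ i) (reverse-↑ Φ (suc i)) q) (≡.trans
      (reverse-↑ (Φ ↑ inject₁ (opposite i)) (inject₁ i) q)
      (cong (λ a → face (Φ ↑ inject₁ (opposite i) ↑ a) (opposite q)) (opposite-inject₁ i))))

  dual-generator : ∀ i F → AD.to (τ i) F ≡ from (σ (opposite i)) F
  dual-generator i = moves-unique Φ {fromDual (τ i)} {inverse (σ j)} (inject₁ j ∷ suc j ∷ []) (inject₁ j ∷ suc j ∷ [])
    (fromDual-moves i) (moves-inverse Φ (σ j) (suc j ∷ inject₁ j ∷ []) (σ-moves j)) (λ _ → ≡.refl)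
    where j = opposite i

  dual-eval : ∀ w F → AD.to (eval AD.Γ τ w) F ≡ to (eval Γ σ (delta w)) F
  dual-eval (gen i) F = dual-generator i F
  dual-eval ε       F = ≡.refl
  dual-eval (u ∙ v) F = ≡.trans (cong (AD.to (eval AD.Γ τ v)) (dual-eval u F)) (dual-eval v _)
  dual-eval (u ⁻¹)  F = injective α (≡.trans (≡.sym (dual-eval u _))
    (≡.trans (AD.to-from (eval AD.Γ τ u) F) (≡.sym (to-from α F))))
    where α = eval Γ σ (delta u)

  private
    module O = Orders Γ
    module Oᵟ = Orders AD.Γ

  dual-times : ∀ i n F → AD.to (n Oᵟ.times τ i) F ≡ to (n O.times inverse (σ (opposite i))) F
  dual-times i zero    F = ≡.refl
  dual-times i (suc n) F = ≡.trans (cong (AD.to (n Oᵟ.times τ i)) (dual-generator i F)) (dual-times i n _)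

  dual-order : ∀ i {p} → HasOrder Γ (σ (opposite i)) p → HasOrder AD.Γ (τ i) p
  dual-order i {p} o = record
    { positive = positive
    ; power = λ F → ≡.trans (dual-times i p F) (O.times-⁻¹ s p power F)
    ; minimal = λ q 0<q e → minimal q 0<q λ F → ≡.trans
        (≡.sym (O.×-congʳ q {inverse (inverse s)} {s} (GroupProperties.⁻¹-involutive Γ s) F))
        (O.times-⁻¹ (inverse s) q (λ G → ≡.trans (≡.sym (dual-times i q G)) (e G)) F)
    }
    where
    open HasOrder o
    s = σ (opposite i)

-- Finiteness and the kernel of the mix

faithfulLabel : ∀ {n N} (P : Polytope n) → Polytope.Face P ↔ Fin N → FaithfulLabel (Automorphisms.Γ P)
-- Transported along the enumeration of faces, an automorphism is a self-map of `Fin N`, and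
-- `funToFin` numbers these maps.
faithfulLabel {N = N} P faces = _ , funToFin ∘ relabel , λ {α} {β} → faithful α β
  where
  open Automorphisms P
  module F = Inverse faces

  relabel : Automorphism → Fin N → Fin N
  relabel α i = F.to (to α (F.from i))

  from-relabel : ∀ α H → F.from (relabel α (F.to H)) ≡ to α H
  from-relabel α H = ≡.trans (F.strictlyInverseʳ _) (cong (to α) (F.strictlyInverseʳ H))

  faithful : ∀ α β → funToFin (relabel α) ≡ funToFin (relabel β) → ∀ H → to α H ≡ to β H
  faithful α β eq H = ≡.trans (≡.sym (from-relabel α H)) (≡.trans (cong F.from same) (from-relabel β H))
    where
    same : relabel α (F.to H) ≡ relabel β (F.to H)
    same = ≡.trans (≡.sym (Finₚ.finToFun-funToFin (relabel α) (F.to H)))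
      (≡.trans (cong (λ c → finToFun c (F.to H)) eq) (Finₚ.finToFun-funToFin (relabel β) (F.to H)))

module Mix {k} (G H : GroupWithGenerators k) where
  private
    module G = GroupWithGenerators G
    module H = GroupWithGenerators H
    module GH = Group (DirectProduct.group G.group H.group)
  open GroupWithGenerators (G ◇ H) using (⟦_⟧; Kernel)

  mix-eval : ∀ w → proj₁ ⟦ w ⟧ ≡ (G.⟦ w ⟧ , H.⟦ w ⟧)
  mix-eval (gen i) = ≡.refl
  mix-eval ε       = ≡.refl
  mix-eval (u ∙ v) = cong₂ GH._∙_ (mix-eval u) (mix-eval v)
  mix-eval (u ⁻¹)  = cong GH._⁻¹ (mix-eval u)

  mix-kernel⁺ : ∀ w → G.Kernel w → H.Kernel w → Kernel w
  mix-kernel⁺ w g h = subst (GH._≈ GH.ε) (≡.sym (mix-eval w)) (g , h)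

  mix-kernel⁻ : ∀ w → Kernel w → G.Kernel w
  mix-kernel⁻ w e = proj₁ (subst (GH._≈ GH.ε) (mix-eval w) e)

-- A word of N equals some `bar v` in W⁺ with v in N, hence in M, and `bar v` is trivial in `A`. The
-- hypothesis `relations` lets the equality in W⁺ be evaluated there.
mix-kernel⊆ : ∀ {k} (G A B : GroupWithGenerators k) →
  let module G = GroupWithGenerators G
      module A = GroupWithGenerators A
      module B = GroupWithGenerators B
      N = GroupWithGenerators.Kernel (G ◇ B) in
  (∀ {w} → W⁺-Relator w → A.Kernel w) → (∀ w → G.Kernel w → A.Kernel (bar w)) →
  (∀ {w} → N w → barImage N w) → ∀ w → G.Kernel w → B.Kernel w → A.Kernel w
mix-kernel⊆ G A B relations bar-kernel N⊆N̄ w g h with N⊆N̄ {w} (Mix.mix-kernel⁺ G B w g h)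
... | v , v∈N , w≈v̄ = trans (eval-respects group generator (λ {u} → relations {u}) w≈v̄)
  (bar-kernel v (Mix.mix-kernel⁻ G B v v∈N))
  where
  open GroupWithGenerators A using (group; generator)
  open Group group using (trans)

-- Chiral polytopes and the conclusion

chiral-moves : ∀ {m} (P : ChiralPolytope m) (_≟_ : DecidableEquality (ChiralPolytope.Face P)) →
  let open ChiralPolytope P in ∀ i → Motion.Moves polytope _≟_ baseFlag (σ i) (suc i ∷ inject₁ i ∷ [])
chiral-moves P _≟_ i = Motion.moves-adjacent polytope _≟_ baseFlag (σ i)
  {suc i} {inject₁ i} {baseFlag ^ suc i} {baseFlag ^ suc i ^ inject₁ i}
  (^-adjacentAt baseFlag (suc i)) (^-adjacentAt (baseFlag ^ suc i) (inject₁ i)) (σ-baseFlag i)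
  where open ChiralPolytope P

open import Data.Nat.Base using (_<_)

module FiniteChiral {m : ℕ} (P : ChiralPolytope m) (finite : Finite P) where
  open ChiralPolytope P using (Γ; σ; baseFlag; polytope)
  module Γ = Group Γ
  module Γᵟ = Group (ChiralPolytope.Γ (P ᵟ))
  module O = Orders Γ
  module Oᵟ = Orders (ChiralPolytope.Γ (P ᵟ))
  open Orders (Free m) using (_times_) public

  σ̄ : Fin m → Γ.Carrier
  σ̄ = ChiralPolytope.σ (mirror P)

  σᵟ : Fin m → Γᵟ.Carrier
  σᵟ = ChiralPolytope.σ (P ᵟ)

  _≟_ : DecidableEquality (ChiralPolytope.Face P)
  _≟_ = Finₚ.inj⇒≟ (↔⇒↣ (proj₂ finite))

  σ-moves : ∀ i → Motion.Moves polytope _≟_ baseFlag (σ i) (suc i ∷ inject₁ i ∷ [])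
  σ-moves = chiral-moves P _≟_

  σ̄-moves : ∀ i → Motion.Moves polytope _≟_ (Flags._↑_ polytope _≟_ baseFlag zero) (σ̄ i) (suc i ∷ inject₁ i ∷ [])
  σ̄-moves i = Motion.moves-resp polytope _≟_ {ChiralPolytope.baseFlag (mirror P)} (σ̄ i) (suc i ∷ inject₁ i ∷ [])
    (Flags.↑-unique polytope _≟_ {baseFlag} {ChiralPolytope.baseFlag (mirror P)} (ChiralPolytope.^-adjacentAt P baseFlag zero))
    (chiral-moves (mirror P) _≟_ i)

  open Dual polytope _≟_ baseFlag σ σ-moves σᵟ (chiral-moves (P ᵟ) _≟_) public using (dual-eval; dual-order)

  module GP = GroupWithGenerators (Γ⁺ P)
  module GM = GroupWithGenerators (Γ⁺ (mirror P))
  module GD = GroupWithGenerators (Γ⁺ (P ᵟ))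

  ev-bar : ∀ w → GM.⟦ bar w ⟧ Γ.≈ GP.⟦ w ⟧
  ev-bar = eval-bar polytope _≟_ baseFlag σ σ̄ σ-moves σ̄-moves

  mirror-relations : ∀ {w} → W⁺-Relator w → GM.Kernel w
  mirror-relations = Rotations.relator-trivial polytope _≟_ (ChiralPolytope.baseFlag (mirror P)) σ̄ (chiral-moves (mirror P) _≟_)

  bar-kernel : ∀ w → GP.Kernel w → GM.Kernel (bar w)
  bar-kernel w e F = ≡.trans (ev-bar w F) (e F)

  -- `u` in the dual and `bar (delta u)` in the mirror image both act on faces as `delta u` does in
  -- P.
  bar-delta-reflects : ∀ u v → GM.⟦ bar (delta u) ⟧ Γ.≈ GM.⟦ bar (delta v) ⟧ → GD.⟦ u ⟧ Γᵟ.≈ GD.⟦ v ⟧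
  bar-delta-reflects u v e F = ≡.trans (dual-eval u F) (≡.trans (≡.sym (ev-bar (delta u) F))
    (≡.trans (e F) (≡.trans (ev-bar (delta v) F) (≡.sym (dual-eval v F)))))

  eval-times : ∀ (G : GroupWithGenerators m) n i → let open GroupWithGenerators G in
         ⟦ n times gen i ⟧ ≈ Orders._times_ group n (generator i)
  eval-times G n i = Homomorphism.homo-times (Free m) group (eval-homomorphism group generator) n (gen i)
    where open GroupWithGenerators G

theorem5p3 : ∀ {m : ℕ} (P : ChiralPolytope m) → Finite P →
    (p : Fin m → ℕ) (type : HasType P p) (a b : ℕ) →
    HasCardinality (Γ⁺ P □ Γ⁺ (mirror P)) a →
    HasCardinality (Γ⁺ P □ Γ⁺ (P ᵟ)) b →
    a < ℓ p (type-nonZero P type) * b →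
    MixChiral P (P ᵟ)
theorem5p3 P finite p type a b cardA cardB a<ℓb (_ , N⊆N̄) = ℕₚ.<⇒≱ a<ℓb
  (comix-bound (Γ⁺ P) (Γ⁺ (mirror P)) (Γ⁺ (P ᵟ))
    (faithfulLabel polytope (proj₂ finite)) (faithfulLabel (dual polytope) (proj₂ finite))
    (mix-kernel⊆ (Γ⁺ P) (Γ⁺ (mirror P)) (Γ⁺ (P ᵟ)) (λ {w} → mirror-relations {w}) bar-kernel (λ {w} → N⊆N̄ {w}))
    (bar ∘ delta) bar-delta-reflects
    (λ i → p i times gen i)
    (λ i → Γ.trans {GP.⟦ p i times gen i ⟧} {p i O.times σ i} {Γ.ε}
      (eval-times (Γ⁺ P) (p i) i) (HasOrder.power (type i)))
    (λ i → Γ.trans {GM.⟦ p i times gen i ⟧} {p i O.times σ̄ i} {Γ.ε}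
      (eval-times (Γ⁺ (mirror P)) (p i) i)
      (times-mirror polytope _≟_ baseFlag σ σ̄ σ-moves σ̄-moves i (p i) (HasOrder.power (type i))))
    (λ i → _/_ (lcm (p i) (p (opposite i))) (p i) {{type-nonZero P type i}})
    (λ i → Oᵟ.order-resp {p i Oᵟ.times σᵟ i} {GD.⟦ p i times gen i ⟧}
      (Γᵟ.sym {GD.⟦ p i times gen i ⟧} {p i Oᵟ.times σᵟ i} (eval-times (Γ⁺ (P ᵟ)) (p i) i))
      -- The i-th generator of the dual has the order `p (opposite i)`, the second argument of the
      -- `lcm`.
      (Oᵟ.order-times (p i) {{type-nonZero P type i}} (dual-order i (type (opposite i)))))
    cardA cardB)
  where
  open ChiralPolytope P using (σ; baseFlag; polytope)
  open FiniteChiral P finite
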